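{- Let $1\leq m\leq n$ be integers. Let $\pi$ be a parking function chosen uniformly at random from the set of all parking functions of length $n$, and let $C_m(\pi)$ be the number of $m$-cycles of $\pi$. Then the expected number of $m$-cycles is $$\mathbb{E}_n(C_m(\pi))=(m-1)!\,\binom{n+1}{m}\Big/(n+1)^{m}.$$
   Context: A parking function of length $n$ is a sequence $\pi=(\pi_1,\dots,\pi_n)$ of positive integers such that, if $\lambda_1\le\cdots\le\lambda_n$ is the weakly increasing rearrangement of $\pi_1,\dots,\pi_n$, then $\lambda_i\le i$ for all $1\le i\le n$. For $m\ge 1$, distinct indices $(i_1,\dots,i_m)$ in $\{1,\dots,n\}$ form an $m$-cycle of $\pi$ if $\pi_{i_1}=i_2,\ \pi_{i_2}=i_3,\dots,\pi_{i_{m-1}}=i_m,\ \pi_{i_m}=i_1$; tuples that differ by a cyclic rotation are regarded as the same $m$-cycle. For $m=1$ an $m$-cycle is a fixed point. $\mathbb{E}_n$ denotes expectation with respect to the uniform measure on the (finite) set of parking functions of length $n$. -}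

module Defs where

open import Data.Fin using (Fin; toℕ)
import Data.Fin as Fin
open import Data.Fin.Properties using (all?; any?; toℕ<n; toℕ-fromℕ<; toℕ-injective)
open import Data.Integer using (+_)
open import Data.List using (List; []; _∷_; [_]; length; lookup; map; filter;
  deduplicate; cartesianProductWith; upTo; allFin)
open import Data.List.Membership.Propositional using (_∈_)
open import Data.List.Membership.Propositional.Properties
  using (∈-lookup; ∈-map⁺; ∈-upTo⁺; ∈-filter⁺; ∈-filter⁻; ∈-cartesianProductWith⁺)
open import Data.List.Relation.Binary.Permutation.Propositional using (↭-sym)
open import Data.List.Relation.Binary.Permutation.Propositional.Properties
  using (↭-length; All-resp-↭; ∈-resp-↭)
import Data.List.Relation.Unary.All as ListAll
open import Data.List.Relation.Unary.Any as Any using (here)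
open import Data.List.Relation.Unary.Any.Properties using (lookup-index)
open import Data.List.Relation.Unary.Unique.Propositional using (Unique)
import Data.List.Relation.Unary.AllPairs as ListAllPairs
import Data.List.Relation.Unary.Unique.Propositional.Properties as Uniqueₚ
open import Data.Nat using (ℕ; zero; suc; _+_; _∸_; _≤_; _≤?_; _≟_; z≤n; s≤s; NonZero)
open import Data.Nat.ListAction using (sum)
open import Data.Nat.DivMod using (_%_; _mod_; m%n<n; m<n⇒m%n≡m; %-distribˡ-+; m%n%n≡m%n; [m+n]%n≡m%n)
open import Data.Nat.Properties using (≤-decTotalOrder; ≤-reflexive; ≤-trans; +-assoc; +-comm;
  +-identityʳ; m+[n∸m]≡n; <⇒≤; suc-injective)
open import Data.Product using (_×_; _,_; proj₁; proj₂; ∃-syntax)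
open import Data.Rational using (ℚ; _/_)
open import Data.Vec as Vec using (Vec; []; _∷_; toList)
open import Data.Vec.Properties using (∷-injective; length-toList)
open import Data.Vec.Relation.Unary.All as VecAll using (All; []; _∷_)
open import Data.Vec.Relation.Unary.AllPairs using (allPairs?)
import Data.Vec.Relation.Unary.Unique.Propositional as VecUnique
open import Function using (_⇔_; mk⇔; Equivalence)
open import Relation.Binary using (Rel; IsEquivalence)
import Relation.Binary as Binary
open import Relation.Binary.PropositionalEquality
  using (_≡_; refl; sym; trans; cong; subst; module ≡-Reasoning)
open import Relation.Nullary using (¬?; _×-dec_)
open import Relation.Unary using (Decidable)

open import Data.List.Sort ≤-decTotalOrder using (sort; sort-↭)

vectors : ∀ {A : Set} → List A → (k : ℕ) → List (Vec A k)
vectors xs zero    = [ [] ]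
vectors xs (suc k) = cartesianProductWith _∷_ xs (vectors xs k)

∈-vectors : ∀ {A : Set} {xs : List A} {k} {v : Vec A k} → All (_∈ xs) v → v ∈ vectors xs k
∈-vectors []       = here refl
∈-vectors (p ∷ ps) = ∈-cartesianProductWith⁺ _∷_ p (∈-vectors ps)

vectors-unique : ∀ {A : Set} {xs : List A} k → Unique xs → Unique (vectors xs k)
vectors-unique zero    _ = ListAll.[] ListAllPairs.∷ ListAllPairs.[]
vectors-unique (suc k) u = Uniqueₚ.cartesianProductWith⁺ _∷_ ∷-injective u (vectors-unique k u)

-- `lookup (sort (toList π)) i` is λ_{i+1}: positions are counted from 0.
IsParkingFunction : ∀ {n} → Vec ℕ n → Set
IsParkingFunction π =
  All (1 ≤_) π × (∀ i → lookup (sort (toList π)) i ≤ suc (toℕ i))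

isParkingFunction? : ∀ {n} → Decidable (IsParkingFunction {n})
isParkingFunction? π =
  VecAll.all? (1 ≤?_) π ×-dec all? (λ i → lookup (sort (toList π)) i ≤? suc (toℕ i))

-- The entries of a parking function of length n lie in {1, …, n}, so filtering
-- {1, …, n}ⁿ loses nothing; see ∈-parkingFunctions.
parkingFunctions : (n : ℕ) → List (Vec ℕ n)
parkingFunctions n = filter isParkingFunction? (vectors (map suc (upTo n)) n)

private
  ∈-range : ∀ {n x} → 1 ≤ x → x ≤ n → x ∈ map suc (upTo n)
  ∈-range {x = suc x} _ x<n = ∈-map⁺ suc (∈-upTo⁺ x<n)

  allToList⁻ : ∀ {P : ℕ → Set} {n} (v : Vec ℕ n) → (∀ {x} → x ∈ toList v → P x) → All P v
  allToList⁻ []      f = []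
  allToList⁻ (x ∷ v) f = f (here refl) ∷ allToList⁻ v (λ p → f (Any.there p))

  entries≤n : ∀ {n} (π : Vec ℕ n) → IsParkingFunction π → ∀ {x} → x ∈ toList π → x ≤ n
  entries≤n {n} π (_ , λ≤) {x} x∈ =
    subst (_≤ n) (sym (lookup-index x∈s))
      (≤-trans (λ≤ (Any.index x∈s))
        (≤-trans (toℕ<n (Any.index x∈s))
          (≤-reflexive (trans (↭-length (sort-↭ (toList π))) (length-toList π)))))
    where
    x∈s : x ∈ sort (toList π)
    x∈s = ∈-resp-↭ (↭-sym (sort-↭ (toList π))) x∈

∈-parkingFunctions : ∀ {n} {π : Vec ℕ n} → π ∈ parkingFunctions n ⇔ IsParkingFunction π
∈-parkingFunctions {n} {π} = mk⇔
  (λ π∈ → proj₂ (∈-filter⁻ isParkingFunction? {xs = vectors (map suc (upTo n)) n} π∈))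
  (λ pf → ∈-filter⁺ isParkingFunction?
    (∈-vectors (VecAll.map (λ (p , q) → ∈-range p q) (VecAll.zip
      (proj₁ pf , allToList⁻ π (entries≤n π pf))))) pf)

parkingFunctions-unique : ∀ n → Unique (parkingFunctions n)
parkingFunctions-unique n = Uniqueₚ.filter⁺ isParkingFunction?
  (vectors-unique n (Uniqueₚ.map⁺ suc-injective (Uniqueₚ.upTo⁺ n)))

parkingFunctions-nonEmpty : ∀ n → NonZero (length (parkingFunctions n))
parkingFunctions-nonEmpty n = nonEmpty (Equivalence.from ∈-parkingFunctions ones)
  where
  nonEmpty : ∀ {A : Set} {x : A} {xs} → x ∈ xs → NonZero (length xs)
  nonEmpty {xs = _ ∷ _} _ = _

  all-ones : ∀ k → ListAll.All (_≤ 1) (toList (Vec.replicate k 1))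
  all-ones zero    = ListAll.[]
  all-ones (suc k) = s≤s z≤n ListAll.∷ all-ones k

  positive : ∀ k → All (1 ≤_) (Vec.replicate k 1)
  positive zero    = []
  positive (suc k) = s≤s z≤n ∷ positive k

  ones : IsParkingFunction (Vec.replicate n 1)
  ones = positive n , λ i → ≤-trans
    (ListAll.lookup (All-resp-↭ (↭-sym (sort-↭ _)) (all-ones n)) (∈-lookup i))
    (s≤s z≤n)

𝔼 : (n : ℕ) → (Vec ℕ n → ℕ) → ℚ
𝔼 n X = _/_ (+ sum (map X (parkingFunctions n))) (length (parkingFunctions n))
  {{parkingFunctions-nonEmpty n}}

-- Indices are elements of Fin n, with j : Fin n standing for the index j + 1;
-- the successor of position k in an m-tuple is taken modulo m.
IsCycle : ∀ {m n} .{{_ : NonZero m}} → Vec ℕ n → Vec (Fin n) m → Set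
IsCycle {m} π is = VecUnique.Unique is ×
  (∀ (k : Fin m) →
    Vec.lookup π (Vec.lookup is k) ≡ suc (toℕ (Vec.lookup is (suc (toℕ k) mod m))))

isCycle? : ∀ {m n} .{{_ : NonZero m}} (π : Vec ℕ n) → Decidable (IsCycle {m} π)
isCycle? {m} π is = allPairs? (λ i j → ¬? (i Fin.≟ j)) is ×-dec
  all? (λ k → Vec.lookup π (Vec.lookup is k) ≟ suc (toℕ (Vec.lookup is (suc (toℕ k) mod m))))

infix 4 _≈ʳ_ _≈ʳ?_

-- is ≈ʳ js when js is a cyclic rotation of is (by r places, to the left).
_≈ʳ_ : ∀ {A : Set} {m} .{{_ : NonZero m}} → Rel (Vec A m) _
_≈ʳ_ {m = m} is js =
  ∃[ r ] (∀ (k : Fin m) → Vec.lookup js k ≡ Vec.lookup is ((toℕ k + toℕ {m} r) mod m))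

_≈ʳ?_ : ∀ {m n} .{{_ : NonZero m}} → Binary.Decidable (_≈ʳ_ {Fin n} {m})
_≈ʳ?_ {m} is js = any? λ r → all? λ k →
  Vec.lookup js k Fin.≟ Vec.lookup is ((toℕ k + toℕ r) mod m)

private
  toℕ-mod : ∀ a m .{{_ : NonZero m}} → toℕ (a mod m) ≡ a % m
  toℕ-mod a m = toℕ-fromℕ< (m%n<n a m)

  mod-cong : ∀ {m a b} .{{_ : NonZero m}} → a % m ≡ b % m → a mod m ≡ b mod m
  mod-cong {m} {a} {b} eq = toℕ-injective (trans (toℕ-mod a m) (trans eq (sym (toℕ-mod b m))))

  mod-toℕ : ∀ {m} .{{_ : NonZero m}} (k : Fin m) → toℕ k mod m ≡ k
  mod-toℕ {m} k = toℕ-injective (trans (toℕ-mod (toℕ k) m) (m<n⇒m%n≡m (toℕ<n k)))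

  %-+ˡ : ∀ a b m .{{_ : NonZero m}} → (a % m + b) % m ≡ (a + b) % m
  %-+ˡ a b m = begin
    (a % m + b) % m          ≡⟨ %-distribˡ-+ (a % m) b m ⟩
    (a % m % m + b % m) % m  ≡⟨ cong (λ x → (x + b % m) % m) (m%n%n≡m%n a m) ⟩
    (a % m + b % m) % m      ≡⟨ %-distribˡ-+ a b m ⟨
    (a + b) % m              ∎
    where open ≡-Reasoning

  %-+ʳ : ∀ a b m .{{_ : NonZero m}} → (a + b % m) % m ≡ (a + b) % m
  %-+ʳ a b m = trans (cong (_% m) (+-comm a (b % m)))
    (trans (%-+ˡ b a m) (cong (_% m) (+-comm b a)))

  shift-shift : ∀ {m} .{{_ : NonZero m}} (k : Fin m) a b →
                (toℕ ((toℕ k + b) mod m) + a) mod m ≡ (toℕ k + (a + b)) mod m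
  shift-shift {m} k a b = mod-cong (begin
    (toℕ ((toℕ k + b) mod m) + a) % m  ≡⟨ cong (λ x → (x + a) % m) (toℕ-mod (toℕ k + b) m) ⟩
    ((toℕ k + b) % m + a) % m          ≡⟨ %-+ˡ (toℕ k + b) a m ⟩
    (toℕ k + b + a) % m                ≡⟨ cong (_% m) (+-assoc (toℕ k) b a) ⟩
    (toℕ k + (b + a)) % m              ≡⟨ cong (λ x → (toℕ k + x) % m) (+-comm b a) ⟩
    (toℕ k + (a + b)) % m              ∎)
    where open ≡-Reasoning

  shift-mod : ∀ {m} .{{_ : NonZero m}} (k : Fin m) a →
              (toℕ k + toℕ (a mod m)) mod m ≡ (toℕ k + a) mod m
  shift-mod {m} k a = mod-cong
    (trans (cong (λ x → (toℕ k + x) % m) (toℕ-mod a m)) (%-+ʳ (toℕ k) a m))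

≈ʳ-isEquivalence : ∀ {A : Set} {m} .{{_ : NonZero m}} → IsEquivalence (_≈ʳ_ {A} {m})
≈ʳ-isEquivalence {m = m} = record
  { refl  = λ {is} → 0 mod m , λ k → cong (Vec.lookup is)
      (sym (trans (shift-mod k 0) (trans (cong (_mod m) (+-identityʳ (toℕ k))) (mod-toℕ k))))
  ; sym   = λ {is} {js} (r , eq) → (m ∸ toℕ r) mod m , λ k → sym (trans
      (cong (Vec.lookup js) (shift-mod k (m ∸ toℕ r)))
      (trans (eq _) (cong (Vec.lookup is) (trans (shift-shift k (toℕ r) (m ∸ toℕ r))
        (trans (cong (λ x → (toℕ k + x) mod m) (m+[n∸m]≡n (<⇒≤ (toℕ<n r))))
          (trans (mod-cong ([m+n]%n≡m%n (toℕ k) m)) (mod-toℕ k)))))))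
  ; trans = λ {is} {js} {ks} (r , eq) (s , eq′) → (toℕ r + toℕ s) mod m , λ k →
      trans (eq′ k) (trans (eq _) (cong (Vec.lookup is)
        (trans (shift-shift k (toℕ r) (toℕ s)) (sym (shift-mod k (toℕ r + toℕ s))))))
  }

-- Deduplicating along the equivalence _≈ʳ_ keeps one tuple from each rotation class.
#cycles : ∀ (m : ℕ) {n} .{{_ : NonZero m}} → Vec ℕ n → ℕ
#cycles m {n} π = length (deduplicate _≈ʳ?_ (filter (isCycle? π) (vectors (allFin n) m)))

{-# OPTIONS --safe #-}

-- Sum over pairs of a parking function π and a tuple (i₁, …, iₘ) forming an m-cycle of π; each
-- cycle is counted m times. Parking functions are closed under permuting positions, and moving
-- i₁, …, iₘ to the front turns π into a parking function whose first m entries i₂, …, iₘ, i₁ are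
-- distinct; the pair can be recovered from it. Having distinct first m entries is invariant under
-- cyclic shifts of the values modulo N = n + 1, and by Pollak's argument every word over ℤ/N of
-- length n has exactly one shift that is a parking function. So there are
-- N (N − 1) ⋯ (N − m + 1) N^(n − m) / N such parking functions out of N^n / N, and dividing
-- by m gives the expectation (m − 1)! C(N, m) / N^m.
module Submission where

open import Defs
open import Data.Bool using (true; false)
open import Data.Fin using (Fin; toℕ; zero; suc; fromℕ<; punchIn; punchOut; _↑ˡ_)
import Data.Fin as Fin
open import Data.Fin.Permutation as Perm using (Permutation′; _⟨$⟩ʳ_; _⟨$⟩ˡ_; inverseʳ; inverseˡ)
open import Data.Fin.Properties using (toℕ<n; toℕ-fromℕ<; toℕ-injective; punchIn-punchOut; punchOut-injective)
import Data.Integer as ℤ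
import Data.Integer.Properties as ℤₚ
open import Data.List as List using (List; []; _∷_; length; map; filter; deduplicate;
  cartesianProduct; cartesianProductWith; allFin; _++_)
open import Data.List.Membership.Propositional using (_∈_; find)
open import Data.List.Membership.Propositional.Properties
  using (∈-map⁺; ∈-map⁻; ∈-filter⁺; ∈-filter⁻; ∈-allFin; ∈-cartesianProduct⁺;
    ∈-cartesianProduct⁻; ∈-deduplicate⁻)
open import Data.List.Membership.Propositional.Properties.WithK using (unique∧set⇒bag)
open import Data.List.Properties using (length-map; length-++; length-tabulate; length-filter;
  filter-++; filter-accept; filter-none; filter-all; filter-complete; map-cong; map-∘; map-tabulate)
open import Data.List.Relation.Binary.BagAndSetEquality using (∼bag⇒↭)
open import Data.List.Relation.Binary.Permutation.Propositional using (_↭_)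
open import Data.List.Relation.Binary.Permutation.Propositional.Properties
  using (↭-length; filter-↭; map⁺)
open import Data.List.Relation.Unary.All as ListAll using ([]; _∷_)
import Data.List.Relation.Unary.All.Properties as ListAllₚ
open import Data.List.Relation.Unary.AllPairs as ListAllPairs using ([]; _∷_)
open import Data.List.Relation.Unary.Any as Any using (here; there)
import Data.List.Relation.Unary.Any.Properties as Anyₚ
open import Data.List.Relation.Unary.Sorted.TotalOrder.Properties using (Sorted⇒AllPairs)
open import Data.List.Relation.Unary.Unique.Propositional using (Unique)
import Data.List.Relation.Unary.Unique.DecSetoid.Properties as DecUniqueₚ
import Data.List.Relation.Unary.Unique.Propositional.Properties as Uniqueₚ
open import Data.Nat as ℕ using (ℕ; zero; suc; pred; _+_; _∸_; _*_; _^_; _!; _≤_; _<_;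
  _≤?_; _<?_; z≤n; s≤s; s≤s⁻¹; NonZero)
open import Data.Nat.Combinatorics using (_C_; nCk≡nPk/k!)
open import Data.Nat.Combinatorics.Base using (_P_; _P′_)
open import Data.Nat.Combinatorics.Specification using (k!∣nP′k; nPk≡n!/[n∸k]!; nP′k≡n!/[n∸k]!)
open import Data.Nat.DivMod as DivMod using (_%_; _mod_; m%n<n; m<n⇒m%n≡m; %-distribˡ-+;
  m%n%n≡m%n; [m+n]%n≡m%n)
open import Data.Nat.ListAction using (sum)
open import Data.Nat.Properties
open import Data.Nat.Tactic.RingSolver using (solve-∀)
open import Data.Product using (_×_; _,_; proj₁; proj₂; ∃-syntax; uncurry)
open import Data.Rational using (_/_)
import Data.Rational.Properties as ℚₚ
open import Data.Rational.Unnormalised using (mkℚᵘ; *≡*)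
open import Data.Sum using (_⊎_; inj₁; inj₂; [_,_])
open import Data.Unit using (tt)
open import Data.Vec as Vec using (Vec; []; _∷_)
import Data.Vec.Membership.DecPropositional as DecMem
import Data.Vec.Membership.Propositional.Properties as VecMemₚ
import Data.Vec.Properties as Vecₚ
import Data.Vec.Relation.Unary.All as VecAll
import Data.Vec.Relation.Unary.All.Properties as VecAllₚ
open import Data.Vec.Relation.Unary.AllPairs using (allPairs?; []; _∷_)
import Data.Vec.Relation.Unary.Any as VecAny
import Data.Vec.Relation.Unary.Any.Properties as VecAnyₚ
import Data.Vec.Relation.Unary.Unique.Propositional as VecUnique
import Data.Vec.Relation.Unary.Unique.Propositional.Properties as VecUniqueₚ
open import Function using (_∘_; _⇔_; mk⇔; Equivalence)
open import Relation.Binary using (IsEquivalence; tri<; tri≈; tri>)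
open import Relation.Binary.PropositionalEquality
  using (_≡_; _≢_; refl; sym; trans; cong; cong₂; subst; subst₂; module ≡-Reasoning)
open import Relation.Nullary using (¬_; ¬?; does; yes; no; contradiction)
open import Relation.Nullary.Decidable using (toSum)
open import Relation.Unary using (Decidable)

open import Algebra.Properties.CommutativeSemigroup +-commutativeSemigroup using (xy∙z≈xz∙y)
open import Data.List.Sort ≤-decTotalOrder using (sort; sort-↭; sort-↗)

-- Cycles are traded for distinct prefixes because shifting the values modulo `N` does not preserve
-- cycles, whereas it does preserve distinctness of entries. The trade is reversible because the
-- permutation used is a fixed function of the tuple: the first `m` entries of the relabelled word
-- are the cycle turned by one place, so they give the tuple, the tuple gives the permutation, and
-- the permutation gives back the original word. For the uniqueness of the shift, let A k be the
-- number of letters of a word that are below k. Subtracting c from all letters yields a parking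
-- function exactly when c is the first place in 0, ..., n where A k - k is least. The inequality is
-- weak after c and strict before it because A k - k drops by one in each turn around the circle: n
-- letters are spread over n + 1 residues.

module _ {A B : Set} (f : A → B) where

  -- Injectivity is asked only on members of the list: the maps counted with below (`turn`,
  -- `straighten`, `word`) are in general not injective on their whole domains.
  Unique-map⁺ : ∀ {xs} → Unique xs → (∀ {x y} → x ∈ xs → y ∈ xs → f x ≡ f y → x ≡ y) →
                Unique (map f xs)
  Unique-map⁺ []       inj = []
  Unique-map⁺ (p ∷ ps) inj =
    ListAllₚ.map⁺ (ListAll.tabulate λ y∈ eq → ListAll.lookup p y∈ (inj (here refl) (there y∈) eq))
    ∷ Unique-map⁺ ps (λ x∈ y∈ → inj (there x∈) (there y∈))

  map-↭ : ∀ {xs ys} → Unique xs → Unique ys →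
          (∀ {x} → x ∈ xs → f x ∈ ys) →
          (∀ {x y} → x ∈ xs → y ∈ xs → f x ≡ f y → x ≡ y) →
          (∀ {y} → y ∈ ys → ∃[ x ] (x ∈ xs × f x ≡ y)) →
          map f xs ↭ ys
  map-↭ xs! ys! into inj surj = ∼bag⇒↭ (unique∧set⇒bag (Unique-map⁺ xs! inj) ys! (mk⇔
    (λ y∈ → let x , x∈ , eq = ∈-map⁻ f y∈ in subst (_∈ _) (sym eq) (into x∈))
    (λ y∈ → let x , x∈ , eq = surj y∈ in subst (_∈ _) eq (∈-map⁺ f x∈))))

  length-bijection : ∀ {xs ys} → Unique xs → Unique ys →
          (∀ {x} → x ∈ xs → f x ∈ ys) →
          (∀ {x y} → x ∈ xs → y ∈ xs → f x ≡ f y → x ≡ y) →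
          (∀ {y} → y ∈ ys → ∃[ x ] (x ∈ xs × f x ≡ y)) →
          length xs ≡ length ys
  length-bijection {xs} xs! ys! into inj surj =
    trans (sym (length-map f xs)) (↭-length (map-↭ xs! ys! into inj surj))

  length-filter-map : ∀ {P : B → Set} (P? : Decidable P) xs →
                      length (filter P? (map f xs)) ≡ length (filter (P? ∘ f) xs)
  length-filter-map P? []       = refl
  length-filter-map P? (x ∷ xs) with does (P? (f x))
  ... | true  = cong suc (length-filter-map P? xs)
  ... | false = length-filter-map P? xs

length-filter-⊎ : ∀ {A : Set} {P Q R : A → Set}
  (P? : Decidable P) (Q? : Decidable Q) (R? : Decidable R) →
  (∀ {x} → R x → P x ⊎ Q x) → (∀ {x} → P x → R x) → (∀ {x} → Q x → R x) →
  (∀ {x} → P x → ¬ Q x) → ∀ xs →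
  length (filter R? xs) ≡ length (filter P? xs) + length (filter Q? xs)
length-filter-⊎ P? Q? R? split l r disj [] = refl
length-filter-⊎ P? Q? R? split l r disj (x ∷ xs)
  with ih ← length-filter-⊎ P? Q? R? split l r disj xs | R? x | P? x | Q? x
... | yes Rx | yes Px | yes Qx = contradiction Qx (disj Px)
... | yes Rx | yes Px | no ¬Qx = cong suc ih
... | yes Rx | no ¬Px | yes Qx = trans (cong suc ih) (sym (+-suc _ _))
... | yes Rx | no ¬Px | no ¬Qx = contradiction (split Rx) [ ¬Px , ¬Qx ]
... | no ¬Rx | yes Px | _      = contradiction (l Px) ¬Rx
... | no ¬Rx | no ¬Px | yes Qx = contradiction (r Qx) ¬Rx
... | no ¬Rx | no ¬Px | no ¬Qx = ih

length-filter-cartesianProduct : ∀ {A B : Set} {P : A × B → Set} (P? : Decidable P) xs ys →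
  length (filter P? (cartesianProduct xs ys)) ≡
  sum (map (λ x → length (filter (λ y → P? (x , y)) ys)) xs)
length-filter-cartesianProduct P? []       ys = refl
length-filter-cartesianProduct P? (x ∷ xs) ys = begin
  length (filter P? (map (x ,_) ys ++ cartesianProduct xs ys))
    ≡⟨ cong length (filter-++ P? (map (x ,_) ys) _) ⟩
  length (filter P? (map (x ,_) ys) ++ filter P? (cartesianProduct xs ys))
    ≡⟨ length-++ (filter P? (map (x ,_) ys)) ⟩
  length (filter P? (map (x ,_) ys)) + length (filter P? (cartesianProduct xs ys))
    ≡⟨ cong₂ _+_ (length-filter-map (x ,_) P? ys) (length-filter-cartesianProduct P? xs ys) ⟩
  length (filter (λ y → P? (x , y)) ys) + sum (map (λ x → length (filter (λ y → P? (x , y)) ys)) xs)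
    ∎
  where open ≡-Reasoning

length-cartesianProductWith : ∀ {A B C : Set} (f : A → B → C) xs ys →
                              length (cartesianProductWith f xs ys) ≡ length xs * length ys
length-cartesianProductWith f []       ys = refl
length-cartesianProductWith f (x ∷ xs) ys = trans (length-++ (map (f x) ys))
  (cong₂ _+_ (length-map (f x) ys) (length-cartesianProductWith f xs ys))

sum-map-const : ∀ {A : Set} (f : A → ℕ) c {xs} → ListAll.All (λ x → f x ≡ c) xs →
                sum (map f xs) ≡ length xs * c
sum-map-const f c []       = refl
sum-map-const f c (p ∷ ps) = cong₂ _+_ p (sum-map-const f c ps)

sum-map-*ˡ : ∀ {A : Set} (f : A → ℕ) c xs → c * sum (map f xs) ≡ sum (map (λ x → c * f x) xs)
sum-map-*ˡ f c []       = *-zeroʳ c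
sum-map-*ˡ f c (x ∷ xs) = trans (*-distribˡ-+ c (f x) _) (cong (c * f x +_) (sum-map-*ˡ f c xs))

length-allFin : ∀ n → length (allFin n) ≡ n
length-allFin n = length-tabulate _

module _ {A : Set} where

  lookup-ext : ∀ {n} {v w : Vec A n} → (∀ i → Vec.lookup v i ≡ Vec.lookup w i) → v ≡ w
  lookup-ext {v = v} {w} eq = trans (sym (Vecₚ.tabulate∘lookup v))
    (trans (Vecₚ.tabulate-cong eq) (Vecₚ.tabulate∘lookup w))

  Unique-lookup⁺ : ∀ {n} {v : Vec A n} →
                   (∀ {i j} → Vec.lookup v i ≡ Vec.lookup v j → i ≡ j) → VecUnique.Unique v
  Unique-lookup⁺ {v = v} inj =
    subst VecUnique.Unique (Vecₚ.tabulate∘lookup v) (VecUniqueₚ.tabulate⁺ inj)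

  Unique-lookup⁻ : ∀ {n} {v : Vec A n} → VecUnique.Unique v →
                   ∀ {i j} → Vec.lookup v i ≡ Vec.lookup v j → i ≡ j
  Unique-lookup⁻ v! = VecUniqueₚ.lookup-injective v! _ _

-- Addition modulo m and rotation of tuples

infixl 6 _⊞_

-- An element of `Fin m` forces `m` to be nonzero, so matching on `suc _` spares most later
-- statements an instance argument. With a natural number as second summand, subtracting `a` is
-- adding `m ∸ a`.
_⊞_ : ∀ {m} → Fin m → ℕ → Fin m
_⊞_ {suc _} k a = (toℕ k + a) mod _

toℕ-⊞ : ∀ {m} .{{_ : NonZero m}} (k : Fin m) a → toℕ (k ⊞ a) ≡ (toℕ k + a) % m
toℕ-⊞ {suc m} k a = toℕ-fromℕ< (m%n<n (toℕ k + a) (suc m))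

⊞-mod : ∀ {m} .{{_ : NonZero m}} (k : Fin m) a → (toℕ k + a) mod m ≡ k ⊞ a
⊞-mod {suc m} k a = refl

⊞-assoc : ∀ {m} (k : Fin m) a b → k ⊞ a ⊞ b ≡ k ⊞ (a + b)
⊞-assoc {m@(suc _)} k a b = toℕ-injective (begin
  toℕ (k ⊞ a ⊞ b)                    ≡⟨ toℕ-⊞ (k ⊞ a) b ⟩
  (toℕ (k ⊞ a) + b) % m              ≡⟨ cong (λ x → (x + b) % m) (toℕ-⊞ k a) ⟩
  ((toℕ k + a) % m + b) % m          ≡⟨ %-distribˡ-+ ((toℕ k + a) % m) b m ⟩
  ((toℕ k + a) % m % m + b % m) % m  ≡⟨ cong (λ x → (x + b % m) % m) (m%n%n≡m%n (toℕ k + a) m) ⟩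
  ((toℕ k + a) % m + b % m) % m      ≡⟨ %-distribˡ-+ (toℕ k + a) b m ⟨
  (toℕ k + a + b) % m                ≡⟨ cong (_% m) (+-assoc (toℕ k) a b) ⟩
  (toℕ k + (a + b)) % m              ≡⟨ toℕ-⊞ k (a + b) ⟨
  toℕ (k ⊞ (a + b))                  ∎)
  where open ≡-Reasoning

⊞-comm : ∀ {m} (k : Fin m) a b → k ⊞ a ⊞ b ≡ k ⊞ b ⊞ a
⊞-comm k a b =
  trans (⊞-assoc k a b) (trans (cong (k ⊞_) (+-comm a b)) (sym (⊞-assoc k b a)))

⊞-swap : ∀ {m} (k l : Fin m) → k ⊞ toℕ l ≡ l ⊞ toℕ k
⊞-swap {suc m} k l = cong (_mod suc m) (+-comm (toℕ k) (toℕ l))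

⊞-period : ∀ {m} (k : Fin m) → k ⊞ m ≡ k
⊞-period {m@(suc _)} k = toℕ-injective
  (trans (toℕ-⊞ k m) (trans ([m+n]%n≡m%n (toℕ k) m) (m<n⇒m%n≡m (toℕ<n k))))

⊞-∸ : ∀ {m a} (k : Fin m) → a ≤ m → k ⊞ a ⊞ (m ∸ a) ≡ k
⊞-∸ {m} {a} k a≤m = trans (⊞-assoc k a (m ∸ a)) (trans (cong (k ⊞_) (m+[n∸m]≡n a≤m)) (⊞-period k))

∸-⊞ : ∀ {m a} (k : Fin m) → a ≤ m → k ⊞ (m ∸ a) ⊞ a ≡ k
∸-⊞ {m} {a} k a≤m = trans (⊞-comm k (m ∸ a) a) (⊞-∸ k a≤m)

⊞-injectiveˡ : ∀ {m a} {k l : Fin m} → a ≤ m → k ⊞ a ≡ l ⊞ a → k ≡ l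
⊞-injectiveˡ {m} {a} {k} {l} a≤m eq =
  trans (sym (⊞-∸ k a≤m)) (trans (cong (_⊞ (m ∸ a)) eq) (⊞-∸ l a≤m))

⊞-injectiveʳ : ∀ {m} (k : Fin m) {r s : Fin m} → k ⊞ toℕ r ≡ k ⊞ toℕ s → r ≡ s
⊞-injectiveʳ k {r} {s} eq =
  ⊞-injectiveˡ (<⇒≤ (toℕ<n k)) (trans (⊞-swap r k) (trans eq (⊞-swap k s)))

suc-mod : ∀ {m} .{{_ : NonZero m}} (k : Fin m) → suc (toℕ k) mod m ≡ k ⊞ 1
suc-mod {m} k = trans (cong (_mod m) (+-comm 1 (toℕ k))) (⊞-mod k 1)

rotate : ∀ {A : Set} {m} → ℕ → Vec A m → Vec A m
rotate r v = Vec.tabulate λ k → Vec.lookup v (k ⊞ r)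

lookup-rotate : ∀ {A : Set} {m} r (v : Vec A m) k → Vec.lookup (rotate r v) k ≡ Vec.lookup v (k ⊞ r)
lookup-rotate r v k = Vecₚ.lookup∘tabulate _ k

≈ʳ-rotate : ∀ {A : Set} {m} .{{_ : NonZero m}} (r : Fin m) (v : Vec A m) → v ≈ʳ rotate (toℕ r) v
≈ʳ-rotate r v = r , λ k → trans (lookup-rotate (toℕ r) v k) (cong (Vec.lookup v) (sym (⊞-mod k (toℕ r))))

≈ʳ⇒rotate : ∀ {A : Set} {m} .{{_ : NonZero m}} {v w : Vec A m} → v ≈ʳ w →
            ∃[ r ] rotate (toℕ {m} r) v ≡ w
≈ʳ⇒rotate {v = v} (r , eq) = r , lookup-ext λ k →
  trans (lookup-rotate (toℕ r) v k) (trans (cong (Vec.lookup v) (sym (⊞-mod k (toℕ r)))) (sym (eq k)))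

Unique-rotate : ∀ {A : Set} {m r} {v : Vec A m} → r ≤ m → VecUnique.Unique v →
                VecUnique.Unique (rotate r v)
Unique-rotate r≤m v! = VecUniqueₚ.tabulate⁺ (⊞-injectiveˡ r≤m ∘ Unique-lookup⁻ v!)

-- Cycles under rotation

module _ {m n} .{{_ : NonZero m}} (π : Vec ℕ n) (is : Vec (Fin n) m) where

  IsCycle-next : IsCycle π is → ∀ k →
                 Vec.lookup π (Vec.lookup is k) ≡ suc (toℕ (Vec.lookup is (k ⊞ 1)))
  IsCycle-next (_ , next) k = trans (next k) (cong (suc ∘ toℕ ∘ Vec.lookup is) (suc-mod k))

  mkIsCycle : VecUnique.Unique is →
              (∀ k → Vec.lookup π (Vec.lookup is k) ≡ suc (toℕ (Vec.lookup is (k ⊞ 1)))) →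
              IsCycle π is
  mkIsCycle is! next =
    is! , λ k → trans (next k) (cong (suc ∘ toℕ ∘ Vec.lookup is) (sym (suc-mod k)))

IsCycle-rotate : ∀ {m n r} .{{_ : NonZero m}} (π : Vec ℕ n) (is : Vec (Fin n) m) →
                 r ≤ m → IsCycle π is → IsCycle π (rotate r is)
IsCycle-rotate {r = r} π is r≤m cyc = mkIsCycle π (rotate r is) (Unique-rotate r≤m (proj₁ cyc)) λ k → begin
  Vec.lookup π (Vec.lookup (rotate r is) k)     ≡⟨ cong (Vec.lookup π) (lookup-rotate r is k) ⟩
  Vec.lookup π (Vec.lookup is (k ⊞ r))          ≡⟨ IsCycle-next π is cyc (k ⊞ r) ⟩
  suc (toℕ (Vec.lookup is (k ⊞ r ⊞ 1)))         ≡⟨ cong (suc ∘ toℕ ∘ Vec.lookup is) (⊞-comm k r 1) ⟩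
  suc (toℕ (Vec.lookup is (k ⊞ 1 ⊞ r)))         ≡⟨ cong (suc ∘ toℕ) (lookup-rotate r is (k ⊞ 1)) ⟨
  suc (toℕ (Vec.lookup (rotate r is) (k ⊞ 1)))  ∎
  where open ≡-Reasoning

∈-vectors-allFin : ∀ {k n} (v : Vec (Fin n) k) → v ∈ vectors (allFin n) k
∈-vectors-allFin v = ∈-vectors (VecAll.universal ∈-allFin v)

-- `AllPairs` relates an entry only to later ones; symmetry of `R` covers the opposite order.
AllPairs-lookup : ∀ {A : Set} {R : A → A → Set} {xs x y} → (∀ {x y} → R x y → R y x) →
                  ListAllPairs.AllPairs R xs → x ∈ xs → y ∈ xs → x ≢ y → R x y
AllPairs-lookup R-sym (p ∷ ps) (here refl) (here refl) x≢y = contradiction refl x≢y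
AllPairs-lookup R-sym (p ∷ ps) (here refl) (there y∈)  x≢y = ListAll.lookup p y∈
AllPairs-lookup R-sym (p ∷ ps) (there x∈)  (here refl) x≢y = R-sym (ListAll.lookup p x∈)
AllPairs-lookup R-sym (p ∷ ps) (there x∈)  (there y∈)  x≢y = AllPairs-lookup R-sym ps x∈ y∈ x≢y

-- Entries of a cycle are distinct, so its m rotations are m different tuples.
*-#cycles : ∀ m {n} .{{_ : NonZero m}} (π : Vec ℕ n) →
            m * #cycles m π ≡ length (filter (isCycle? π) (vectors (allFin n) m))
*-#cycles m@(suc _) {n} π = begin
  m * length reps                            ≡⟨ cong (_* length reps) (length-allFin m) ⟨
  length (allFin m) * length reps            ≡⟨ length-cartesianProductWith _,_ (allFin m) reps ⟨
  length (cartesianProduct (allFin m) reps)  ≡⟨ length-bijection turn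
    (Uniqueₚ.cartesianProduct⁺ (Uniqueₚ.allFin⁺ m) reps!) cycles! into inj surj ⟩
  length cycles                              ∎
  where
  open ≡-Reasoning
  cycles = filter (isCycle? {m} π) (vectors (allFin n) m)
  reps   = deduplicate _≈ʳ?_ cycles

  ≈-refl : ∀ is → is ≈ʳ is
  ≈-refl is = IsEquivalence.refl (≈ʳ-isEquivalence {Fin n} {m}) {is}

  ≈-sym : ∀ is js → is ≈ʳ js → js ≈ʳ is
  ≈-sym is js = IsEquivalence.sym (≈ʳ-isEquivalence {Fin n} {m}) {is} {js}

  ≈-trans : ∀ is js ks → is ≈ʳ js → js ≈ʳ ks → is ≈ʳ ks
  ≈-trans is js ks = IsEquivalence.trans (≈ʳ-isEquivalence {Fin n} {m}) {is} {js} {ks}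

  turn : Fin m × Vec (Fin n) m → Vec (Fin n) m
  turn (r , is) = rotate (toℕ r) is

  ∈-cycles⁻ : ∀ is → is ∈ reps → IsCycle π is
  ∈-cycles⁻ is = proj₂ ∘ ∈-filter⁻ (isCycle? π) {xs = vectors (allFin n) m} ∘ ∈-deduplicate⁻ _≈ʳ?_ cycles

  cycles! : Unique cycles
  cycles! = Uniqueₚ.filter⁺ (isCycle? π) (vectors-unique m (Uniqueₚ.allFin⁺ n))

  inequivalent : ListAllPairs.AllPairs (λ is js → ¬ is ≈ʳ js) reps
  inequivalent = DecUniqueₚ.deduplicate-! (record { isDecEquivalence =
    record { isEquivalence = ≈ʳ-isEquivalence ; _≟_ = _≈ʳ?_ } }) cycles

  reps! : Unique reps
  reps! = ListAllPairs.map (λ { {is} is≉js refl → is≉js (≈-refl is) }) inequivalent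

  into : ∀ {x} → x ∈ cartesianProduct (allFin m) reps → turn x ∈ cycles
  into {r , is} x∈ = ∈-filter⁺ (isCycle? π) (∈-vectors-allFin _)
    (IsCycle-rotate π is (<⇒≤ (toℕ<n r)) (∈-cycles⁻ is (proj₂ (∈-cartesianProduct⁻ (allFin m) reps x∈))))

  inj : ∀ {x y} → x ∈ cartesianProduct (allFin m) reps → y ∈ cartesianProduct (allFin m) reps →
        turn x ≡ turn y → x ≡ y
  inj {r , is} {s , js} x∈ y∈ eq with Vecₚ.≡-dec Fin._≟_ is js
  -- Equal turns make `is` and `js` rotations of one another, but distinct representatives that
  -- survive deduplication are inequivalent.
  ... | no is≢js = contradiction
    (≈-trans is (rotate (toℕ r) is) js (≈ʳ-rotate r is)
      (subst (_≈ʳ js) (sym eq) (≈-sym js (rotate (toℕ s) js) (≈ʳ-rotate s js))))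
    (AllPairs-lookup (λ {is} {js} is≉js → is≉js ∘ ≈-sym js is) inequivalent
      (proj₂ (∈-cartesianProduct⁻ (allFin m) reps x∈))
      (proj₂ (∈-cartesianProduct⁻ (allFin m) reps y∈)) is≢js)
  -- Position `zero` of the two turns shows the entries of `is` at `r` and at `s`; since the entries
  -- are distinct, `r` equals `s`.
  ... | yes refl = cong (_, is) (⊞-injectiveʳ zero (Unique-lookup⁻
    (proj₁ (∈-cycles⁻ is (proj₂ (∈-cartesianProduct⁻ (allFin m) reps x∈))))
    (trans (sym (lookup-rotate (toℕ r) is zero))
      (trans (cong (λ v → Vec.lookup v zero) eq) (lookup-rotate (toℕ s) is zero)))))

  surj : ∀ {js} → js ∈ cycles → ∃[ x ] (x ∈ cartesianProduct (allFin m) reps × turn x ≡ js)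
  surj {js} js∈ =
    let near = Anyₚ.deduplicate⁺ _≈ʳ?_ {P = _≈ʳ js} (λ {x} {y} y≈x x≈js → ≈-trans y x js y≈x x≈js)
                 (Any.map (λ eq → subst (_≈ʳ js) eq (≈-refl js)) js∈)
        is , is∈ , is≈js = find near
        r , eq = ≈ʳ⇒rotate {v = is} is≈js
    in (r , is) , ∈-cartesianProduct⁺ (∈-allFin r) is∈ , eq

-- Parking functions and the positions of a cycle

-- The parking condition without sorting: a count does not depend on the order of the entries, so
-- invariance under permuting positions is immediate in this form.
Dominates : ℕ → List ℕ → Set
Dominates n xs = ∀ j → j ≤ n → j ≤ length (filter (_≤? j) xs)

-- The first `j` entries are all counted. The bound `b` is kept apart from `j` because the induction
-- lowers `j` and leaves `b` fixed.
lookup≤⇒count : ∀ xs j b → j ≤ length xs →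
  (∀ i → toℕ i < j → List.lookup xs i ≤ b) → j ≤ length (filter (_≤? b) xs)
lookup≤⇒count xs       zero    b _         h = z≤n
lookup≤⇒count (x ∷ xs) (suc j) b (s≤s j≤n) h = ≤-trans
  (s≤s (lookup≤⇒count xs j b j≤n (λ i i<j → h (suc i) (s≤s i<j))))
  (≤-reflexive (cong length (sym (filter-accept (_≤? b) (h zero (s≤s z≤n))))))

-- In a sorted list the entries that are at most `b` form a prefix; once the head exceeds `b`,
-- nothing is counted.
count⇒lookup≤ : ∀ {xs} → ListAllPairs.AllPairs _≤_ xs → ∀ i b →
                toℕ i < length (filter (_≤? b) xs) → List.lookup xs i ≤ b
count⇒lookup≤ {x ∷ xs} (x≤xs ∷ xs↗) i b i<count with x ≤? b
count⇒lookup≤ {x ∷ xs} (x≤xs ∷ xs↗) zero    b i<count | yes x≤b = x≤b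
count⇒lookup≤ {x ∷ xs} (x≤xs ∷ xs↗) (suc i) b i<count | yes x≤b =
  count⇒lookup≤ xs↗ i b
    (s≤s⁻¹ (subst (suc (toℕ i) <_) (cong length (filter-accept (_≤? b) x≤b)) i<count))
... | no x≰b = contradiction
  (subst (toℕ i <_) (cong length (filter-none (_≤? b)
    (x≰b ∷ ListAll.map (λ x≤y y≤b → x≰b (≤-trans x≤y y≤b)) x≤xs))) i<count)
  λ ()

count-↭ : ∀ {xs ys : List ℕ} b → xs ↭ ys → length (filter (_≤? b) xs) ≡ length (filter (_≤? b) ys)
count-↭ b p = ↭-length (filter-↭ (_≤? b) p)

length-sort : ∀ {n} (π : Vec ℕ n) → length (sort (Vec.toList π)) ≡ n
length-sort π = trans (↭-length (sort-↭ (Vec.toList π))) (Vecₚ.length-toList π)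

IsParkingFunction⇒Dominates : ∀ {n} (π : Vec ℕ n) → IsParkingFunction π → Dominates n (Vec.toList π)
IsParkingFunction⇒Dominates π (_ , λ≤) j j≤n = subst (j ≤_) (count-↭ j (sort-↭ (Vec.toList π)))
  (lookup≤⇒count (sort (Vec.toList π)) j j (subst (j ≤_) (sym (length-sort π)) j≤n)
    (λ i i<j → ≤-trans (λ≤ i) i<j))

Dominates⇒IsParkingFunction : ∀ {n} (π : Vec ℕ n) → VecAll.All (1 ≤_) π →
                              Dominates n (Vec.toList π) → IsParkingFunction π
Dominates⇒IsParkingFunction {n} π 1≤π dom = 1≤π , λ i →
  count⇒lookup≤ (Sorted⇒AllPairs ≤-totalOrder (sort-↗ (Vec.toList π))) i (suc (toℕ i))
    (subst (suc (toℕ i) ≤_) (sym (count-↭ (suc (toℕ i)) (sort-↭ (Vec.toList π))))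
      (dom (suc (toℕ i)) (subst (toℕ i <_) (length-sort π) (toℕ<n i))))

toList≡map-lookup : ∀ {A : Set} {n} (v : Vec A n) → Vec.toList v ≡ map (Vec.lookup v) (allFin n)
toList≡map-lookup []      = refl
toList≡map-lookup (x ∷ v) = cong (x ∷_) (begin
  Vec.toList v                          ≡⟨ toList≡map-lookup v ⟩
  map (Vec.lookup v) (allFin _)         ≡⟨ map-tabulate _ (Vec.lookup v) ⟩
  List.tabulate (Vec.lookup v)          ≡⟨ map-tabulate suc (Vec.lookup (x ∷ v)) ⟨
  map (Vec.lookup (x ∷ v)) (List.tabulate suc) ∎)
  where open ≡-Reasoning

permute : ∀ {A : Set} {n} → Permutation′ n → Vec A n → Vec A n
permute σ v = Vec.tabulate λ i → Vec.lookup v (σ ⟨$⟩ʳ i)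

lookup-permute : ∀ {A : Set} {n} (σ : Permutation′ n) (v : Vec A n) i →
                 Vec.lookup (permute σ v) i ≡ Vec.lookup v (σ ⟨$⟩ʳ i)
lookup-permute σ v i = Vecₚ.lookup∘tabulate _ i

⟨$⟩ʳ-injective : ∀ {n} (σ : Permutation′ n) {i j} → σ ⟨$⟩ʳ i ≡ σ ⟨$⟩ʳ j → i ≡ j
⟨$⟩ʳ-injective σ eq = trans (sym (inverseˡ σ)) (trans (cong (σ ⟨$⟩ˡ_) eq) (inverseˡ σ))

permute-injective : ∀ {A : Set} {n} (σ : Permutation′ n) {v w : Vec A n} → permute σ v ≡ permute σ w → v ≡ w
permute-injective σ {v} {w} eq = lookup-ext λ i → begin
  Vec.lookup v i                       ≡⟨ cong (Vec.lookup v) (inverseʳ σ) ⟨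
  Vec.lookup v (σ ⟨$⟩ʳ (σ ⟨$⟩ˡ i))      ≡⟨ lookup-permute σ v _ ⟨
  Vec.lookup (permute σ v) (σ ⟨$⟩ˡ i)  ≡⟨ cong (λ u → Vec.lookup u (σ ⟨$⟩ˡ i)) eq ⟩
  Vec.lookup (permute σ w) (σ ⟨$⟩ˡ i)  ≡⟨ lookup-permute σ w _ ⟩
  Vec.lookup w (σ ⟨$⟩ʳ (σ ⟨$⟩ˡ i))      ≡⟨ cong (Vec.lookup w) (inverseʳ σ) ⟩
  Vec.lookup w i                       ∎
  where open ≡-Reasoning

permute-flip : ∀ {A : Set} {n} (σ : Permutation′ n) (v : Vec A n) → permute σ (permute (Perm.flip σ) v) ≡ v
permute-flip σ v = lookup-ext λ i → trans (lookup-permute σ (permute (Perm.flip σ) v) i)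
  (trans (lookup-permute (Perm.flip σ) v _) (cong (Vec.lookup v) (inverseˡ σ)))

toList-permute-↭ : ∀ {A : Set} {n} (σ : Permutation′ n) (v : Vec A n) → Vec.toList (permute σ v) ↭ Vec.toList v
toList-permute-↭ {n = n} σ v = subst (_↭ Vec.toList v) permuted
  (subst (map (Vec.lookup v) (map (σ ⟨$⟩ʳ_) (allFin n)) ↭_) (sym (toList≡map-lookup v))
    (map⁺ (Vec.lookup v) (map-↭ (σ ⟨$⟩ʳ_) (Uniqueₚ.allFin⁺ n) (Uniqueₚ.allFin⁺ n)
      (λ _ → ∈-allFin _) (λ _ _ → ⟨$⟩ʳ-injective σ)
      (λ {i} _ → σ ⟨$⟩ˡ i , ∈-allFin _ , inverseʳ σ))))
  where
  open ≡-Reasoning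
  permuted : map (Vec.lookup v) (map (σ ⟨$⟩ʳ_) (allFin n)) ≡ Vec.toList (permute σ v)
  permuted = begin
    map (Vec.lookup v) (map (σ ⟨$⟩ʳ_) (allFin n))  ≡⟨ map-∘ (allFin n) ⟨
    map (λ i → Vec.lookup v (σ ⟨$⟩ʳ i)) (allFin n)  ≡⟨ map-cong (lookup-permute σ v) (allFin n) ⟨
    map (Vec.lookup (permute σ v)) (allFin n)      ≡⟨ toList≡map-lookup (permute σ v) ⟨
    Vec.toList (permute σ v)                       ∎

IsParkingFunction-permute : ∀ {n} (σ : Permutation′ n) (π : Vec ℕ n) →
                            IsParkingFunction π → IsParkingFunction (permute σ π)
IsParkingFunction-permute σ π pf@(1≤π , _) = Dominates⇒IsParkingFunction (permute σ π)
  (VecAllₚ.tabulate⁺ λ i → VecAllₚ.lookup⁺ 1≤π (σ ⟨$⟩ʳ i))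
  λ j j≤n → subst (j ≤_) (sym (count-↭ j (toList-permute-↭ σ π)))
              (IsParkingFunction⇒Dominates π pf j j≤n)

-- Domination at `j = n` says that at least `n` of the `n` entries are at most `n`, so filtering by
-- this bound removes nothing.
IsParkingFunction⇒≤ : ∀ {n} (π : Vec ℕ n) → IsParkingFunction π → ∀ i → Vec.lookup π i ≤ n
IsParkingFunction⇒≤ {n} π pf i = VecAllₚ.lookup⁺ (VecAllₚ.toList⁻ all≤) i
  where
  all≤ : ListAll.All (_≤ n) (Vec.toList π)
  all≤ = subst (ListAll.All (_≤ n)) (filter-complete (_≤? n) (≤-antisym (length-filter (_≤? n) (Vec.toList π))
    (subst (_≤ length (filter (_≤? n) (Vec.toList π))) (sym (Vecₚ.length-toList π))
      (IsParkingFunction⇒Dominates π pf n ≤-refl))))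
    (ListAllₚ.all-filter (_≤? n) (Vec.toList π))

lookup-take : ∀ {A : Set} m {d} (v : Vec A (m + d)) k → Vec.lookup (Vec.take m v) k ≡ Vec.lookup v (k ↑ˡ d)
lookup-take (suc m) (x ∷ v) zero    = refl
lookup-take (suc m) (x ∷ v) (suc k) = lookup-take m v k

-- Position zero is sent to `i`. The remaining entries avoid `i`, so punching `i` out turns them
-- into distinct elements of a set smaller by one, and `Perm.insert` puts the permutation found for
-- them back around `i`.
extend : ∀ {m} d {is : Vec (Fin (m + d)) m} → VecUnique.Unique is →
         ∃[ σ ] (∀ k → σ ⟨$⟩ʳ (k ↑ˡ d) ≡ Vec.lookup is k)
extend d {[]}     _          = Perm.id , λ ()
extend d {i ∷ is} (i∉ ∷ is!) = Perm.insert zero i σ , λ where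
    zero    → refl
    (suc k) → trans (Perm.insert-punchIn zero i σ (k ↑ˡ d))
      (trans (cong (punchIn i) (trans (σ-is k) (Vecₚ.lookup∘tabulate _ k)))
        (punchIn-punchOut (i≢ k)))
  where
  i≢ = VecAllₚ.lookup⁺ i∉
  rec = extend d (VecUniqueₚ.tabulate⁺ {f = λ k → punchOut (i≢ k)} λ {j} {k} eq →
    Unique-lookup⁻ is! (punchOut-injective (i≢ j) (i≢ k) eq))
  σ = proj₁ rec
  σ-is = proj₂ rec

unique? : ∀ {n k} → Decidable (VecUnique.Unique {A = Fin n} {k})
unique? = allPairs? λ i j → ¬? (i Fin.≟ j)

-- It depends on the tuple alone, so recovering the tuple from a relabelled word also recovers the
-- permutation. The identity is a default value for tuples with repetitions.
completion : ∀ {m} d → Vec (Fin (m + d)) m → Permutation′ (m + d)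
completion d is with unique? is
... | yes is! = proj₁ (extend d is!)
... | no  _   = Perm.id

completion-↑ˡ : ∀ {m} d {is : Vec (Fin (m + d)) m} → VecUnique.Unique is →
                ∀ k → completion d is ⟨$⟩ʳ (k ↑ˡ d) ≡ Vec.lookup is k
completion-↑ˡ d {is} is! with unique? is
... | yes is!′ = proj₂ (extend d is!′)
... | no ¬is!  = contradiction is! ¬is!

module DistinctPrefix (m d : ℕ) where

  private
    n : ℕ
    n = m + d

  distinctPrefix? : Decidable (λ (π : Vec ℕ n) → VecUnique.Unique (Vec.take m π))
  distinctPrefix? π = allPairs? (λ i j → ¬? (i ℕ.≟ j)) (Vec.take m π)

  distinctPrefix : List (Vec ℕ n)
  distinctPrefix = filter distinctPrefix? (parkingFunctions n)

-- Relabelling the positions by a permutation that sends 1, …, m to the cycle i₁, …, iₘ turns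
-- π into a parking function with first m entries i₂, …, iₘ, i₁, from which the cycle can be read off.
module CyclesAsPrefixes (m d : ℕ) .{{_ : NonZero m}} where

  open DistinctPrefix m d

  private
    n : ℕ
    n = m + d

  IsCycleOf? : Decidable (uncurry (IsCycle {m} {n}))
  IsCycleOf? (π , is) = isCycle? π is

  pairs : List (Vec ℕ n × Vec (Fin n) m)
  pairs = cartesianProduct (parkingFunctions n) (vectors (allFin n) m)

  ∈-pairs⁻ : ∀ {π is} → (π , is) ∈ filter IsCycleOf? pairs → IsParkingFunction π × IsCycle π is
  ∈-pairs⁻ x∈ =
    let x∈′ , cyc = ∈-filter⁻ IsCycleOf? {xs = pairs} x∈
    in Equivalence.to ∈-parkingFunctions
         (proj₁ (∈-cartesianProduct⁻ (parkingFunctions n) (vectors (allFin n) m) x∈′)) , cyc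

  straighten : Vec ℕ n × Vec (Fin n) m → Vec ℕ n
  straighten (π , is) = permute (completion d is) π

  lookup-straighten : ∀ π is → IsCycle π is → ∀ k →
    Vec.lookup (Vec.take m (straighten (π , is))) k ≡ suc (toℕ (Vec.lookup is (k ⊞ 1)))
  lookup-straighten π is cyc k = begin
    Vec.lookup (Vec.take m (straighten (π , is))) k     ≡⟨ lookup-take m _ k ⟩
    Vec.lookup (straighten (π , is)) (k ↑ˡ d)           ≡⟨ lookup-permute (completion d is) π _ ⟩
    Vec.lookup π (completion d is ⟨$⟩ʳ (k ↑ˡ d))         ≡⟨ cong (Vec.lookup π) (completion-↑ˡ d (proj₁ cyc) k) ⟩
    Vec.lookup π (Vec.lookup is k)                      ≡⟨ IsCycle-next π is cyc k ⟩
    suc (toℕ (Vec.lookup is (k ⊞ 1)))                   ∎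
    where open ≡-Reasoning

  1≤m : 1 ≤ m
  1≤m = ℕ.>-nonZero⁻¹ m

  straighten-injective : ∀ π is ρ js → IsCycle π is → IsCycle ρ js →
                         straighten (π , is) ≡ straighten (ρ , js) → (π , is) ≡ (ρ , js)
  straighten-injective π is ρ js cyc cyc′ eq with lookup-ext {v = is} {js} is≡js
    where
    open ≡-Reasoning
    next : ∀ k → Vec.lookup is (k ⊞ 1) ≡ Vec.lookup js (k ⊞ 1)
    next k = toℕ-injective (suc-injective (begin
      suc (toℕ (Vec.lookup is (k ⊞ 1)))                ≡⟨ lookup-straighten π is cyc k ⟨
      Vec.lookup (Vec.take m (straighten (π , is))) k  ≡⟨ cong (λ v → Vec.lookup (Vec.take m v) k) eq ⟩
      Vec.lookup (Vec.take m (straighten (ρ , js))) k  ≡⟨ lookup-straighten ρ js cyc′ k ⟩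
      suc (toℕ (Vec.lookup js (k ⊞ 1)))                ∎))

    is≡js : ∀ k → Vec.lookup is k ≡ Vec.lookup js k
    -- The prefix shows only successors, but every position is one: `k` equals `k ⊞ (m ∸ 1) ⊞ 1`.
    is≡js k = subst (λ k → Vec.lookup is k ≡ Vec.lookup js k) (∸-⊞ k 1≤m) (next (k ⊞ (m ∸ 1)))
  -- Equal tuples have the same completion, and permuting by it can be undone.
  ... | refl = cong (_, is) (permute-injective (completion d is) eq)

  straighten-surjective : ∀ ρ → IsParkingFunction ρ → VecUnique.Unique (Vec.take m ρ) →
    ∃[ π ] ∃[ is ] (IsParkingFunction π × IsCycle π is × straighten (π , is) ≡ ρ)
  straighten-surjective ρ pf ρ! =
    permute (Perm.flip σ) ρ , is , IsParkingFunction-permute (Perm.flip σ) ρ pf ,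
    mkIsCycle (permute (Perm.flip σ) ρ) is is! next , permute-flip σ ρ
    where
    open ≡-Reasoning
    -- The entries of a parking function lie in 1, ..., n, so each one minus one is an index.
    entry : ∀ i → ∃[ x ] suc (toℕ {n} x) ≡ Vec.lookup ρ i
    entry i with Vec.lookup ρ i | VecAllₚ.lookup⁺ (proj₁ pf) i | IsParkingFunction⇒≤ ρ pf i
    ... | suc x | s≤s _ | x<n = fromℕ< x<n , cong suc (toℕ-fromℕ< x<n)

    first : Vec (Fin n) m
    first = Vec.tabulate λ k → proj₁ (entry (k ↑ˡ d))

    lookup-first : ∀ k → suc (toℕ (Vec.lookup first k)) ≡ Vec.lookup ρ (k ↑ˡ d)
    lookup-first k = trans (cong (suc ∘ toℕ) (Vecₚ.lookup∘tabulate _ k)) (proj₂ (entry (k ↑ˡ d)))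

    first! : VecUnique.Unique first
    first! = Unique-lookup⁺ λ {j} {k} eq → Unique-lookup⁻ ρ! (begin
      Vec.lookup (Vec.take m ρ) j        ≡⟨ lookup-take m ρ j ⟩
      Vec.lookup ρ (j ↑ˡ d)              ≡⟨ lookup-first j ⟨
      suc (toℕ (Vec.lookup first j))     ≡⟨ cong (suc ∘ toℕ) eq ⟩
      suc (toℕ (Vec.lookup first k))     ≡⟨ lookup-first k ⟩
      Vec.lookup ρ (k ↑ˡ d)              ≡⟨ lookup-take m ρ k ⟨
      Vec.lookup (Vec.take m ρ) k        ∎)

    -- `first` reads i₂, ..., iₘ, i₁; turning it by `m ∸ 1` places brings i₁ to the front.
    is : Vec (Fin n) m
    is = rotate (m ∸ 1) first

    is! : VecUnique.Unique is
    is! = Unique-rotate (m∸n≤m m 1) first!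

    σ : Permutation′ n
    σ = completion d is

    next : ∀ k → Vec.lookup (permute (Perm.flip σ) ρ) (Vec.lookup is k) ≡ suc (toℕ (Vec.lookup is (k ⊞ 1)))
    next k = begin
      Vec.lookup (permute (Perm.flip σ) ρ) (Vec.lookup is k)  ≡⟨ lookup-permute (Perm.flip σ) ρ _ ⟩
      Vec.lookup ρ (σ ⟨$⟩ˡ Vec.lookup is k)
        ≡⟨ cong (λ i → Vec.lookup ρ (σ ⟨$⟩ˡ i)) (completion-↑ˡ d is! k) ⟨
      Vec.lookup ρ (σ ⟨$⟩ˡ (σ ⟨$⟩ʳ (k ↑ˡ d)))                  ≡⟨ cong (Vec.lookup ρ) (inverseˡ σ) ⟩
      Vec.lookup ρ (k ↑ˡ d)                                   ≡⟨ lookup-first k ⟨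
      suc (toℕ (Vec.lookup first k))
        ≡⟨ cong (suc ∘ toℕ ∘ Vec.lookup first) (⊞-∸ k 1≤m) ⟨
      suc (toℕ (Vec.lookup first (k ⊞ 1 ⊞ (m ∸ 1))))
        ≡⟨ cong (suc ∘ toℕ) (lookup-rotate (m ∸ 1) first (k ⊞ 1)) ⟨
      suc (toℕ (Vec.lookup is (k ⊞ 1)))                       ∎

  cyclePairs≡distinctPrefix : length (filter IsCycleOf? pairs) ≡ length distinctPrefix
  cyclePairs≡distinctPrefix = length-bijection straighten
    (Uniqueₚ.filter⁺ IsCycleOf? (Uniqueₚ.cartesianProduct⁺ (parkingFunctions-unique n)
      (vectors-unique m (Uniqueₚ.allFin⁺ n))))
    (Uniqueₚ.filter⁺ _ (parkingFunctions-unique n))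
    (λ {(π , is)} x∈ → let pf , cyc = ∈-pairs⁻ x∈ in ∈-filter⁺ _
      (Equivalence.from ∈-parkingFunctions (IsParkingFunction-permute (completion d is) π pf))
      (Unique-lookup⁺ λ {j} {k} eq → ⊞-injectiveˡ 1≤m (Unique-lookup⁻ (proj₁ cyc) (toℕ-injective
        (suc-injective (trans (sym (lookup-straighten π is cyc j))
          (trans eq (lookup-straighten π is cyc k))))))))
    (λ x∈ y∈ → let _ , cyc = ∈-pairs⁻ x∈ ; _ , cyc′ = ∈-pairs⁻ y∈
               in straighten-injective _ _ _ _ cyc cyc′)
    (λ {ρ} ρ∈ →
      let ρ∈′ , ρ! = ∈-filter⁻ _ {xs = parkingFunctions n} ρ∈
          π , is , pf , cyc , eq = straighten-surjective ρ (Equivalence.to ∈-parkingFunctions ρ∈′) ρ!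
      in (π , is) , ∈-filter⁺ IsCycleOf? (∈-cartesianProduct⁺
           (Equivalence.from ∈-parkingFunctions pf) (∈-vectors-allFin is)) cyc , eq)

  *-sum-#cycles : m * sum (map (#cycles m) (parkingFunctions n)) ≡ length distinctPrefix
  *-sum-#cycles = begin
    m * sum (map (#cycles m) (parkingFunctions n))          ≡⟨ sum-map-*ˡ (#cycles m) m (parkingFunctions n) ⟩
    sum (map (λ π → m * #cycles m π) (parkingFunctions n))
      ≡⟨ cong sum (map-cong (*-#cycles m) (parkingFunctions n)) ⟩
    sum (map (λ π → length (filter (isCycle? π) (vectors (allFin n) m))) (parkingFunctions n))
      ≡⟨ length-filter-cartesianProduct IsCycleOf? (parkingFunctions n) (vectors (allFin n) m) ⟨
    length (filter IsCycleOf? pairs)                        ≡⟨ cyclePairs≡distinctPrefix ⟩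
    length distinctPrefix                                   ∎
    where open ≡-Reasoning

-- A c − c ≤ A k − k for all k ≤ n, strictly when k < c: the first minimum of A k − k.
FirstMin : (ℕ → ℕ) → ℕ → ℕ → Set
FirstMin A n c = (∀ {k} → c ≤ k → k ≤ n → k + A c ≤ A k + c) × (∀ {k} → k < c → k + A c < A k + c)

-- For two candidates, weak minimality of the smaller one, evaluated at the larger, contradicts
-- strict minimality of the larger one, evaluated at the smaller.
FirstMin-unique : ∀ {A n c c′} → c ≤ n → c′ ≤ n → FirstMin A n c → FirstMin A n c′ → c ≡ c′
FirstMin-unique {A} {c = c} {c′} c≤n c′≤n (later , earlier) (later′ , earlier′) with <-cmp c c′
... | tri≈ _ c≡c′ _ = c≡c′
... | tri< c<c′ _ _ = contradiction (later (<⇒≤ c<c′) c′≤n)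
  (<⇒≱ (subst (_< c′ + A c) (+-comm c (A c′)) (subst (c + A c′ <_) (+-comm (A c) c′) (earlier′ c<c′))))
... | tri> _ _ c′<c = contradiction (later′ (<⇒≤ c′<c) c≤n)
  (<⇒≱ (subst (_< c + A c′) (+-comm c′ (A c)) (subst (c′ + A c <_) (+-comm (A c′) c) (earlier c′<c))))

-- A running minimum: when the range grows by one point, `c` is kept unless the value at the new
-- point is strictly lower.
firstMin : ∀ A n → ∃[ c ] (c ≤ n × FirstMin A n c)
firstMin A zero = 0 , z≤n , (λ { z≤n z≤n → ≤-reflexive (+-comm 0 (A 0)) }) , λ ()
firstMin A (suc n) with firstMin A n
... | c , c≤n , later , earlier with suc n + A c ≤? A (suc n) + c
...   | yes le = c , m≤n⇒m≤1+n c≤n , later′ , earlier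
  where
  later′ : ∀ {k} → c ≤ k → k ≤ suc n → k + A c ≤ A k + c
  later′ c≤k k≤1+n with m≤n⇒m<n∨m≡n k≤1+n
  ... | inj₁ k<1+n = later c≤k (s≤s⁻¹ k<1+n)
  ... | inj₂ refl  = le
...   | no ≰ = suc n , ≤-refl ,
  (λ 1+n≤k k≤1+n → ≤-reflexive (tied (≤-antisym k≤1+n 1+n≤k))) , λ k<1+n → below-new (s≤s⁻¹ k<1+n)
  where
  tied : ∀ {k} → k ≡ suc n → k + A (suc n) ≡ A k + suc n
  tied refl = +-comm (suc n) (A (suc n))

  weak : ∀ {k} → k ≤ n → k + A c ≤ A k + c
  weak {k} k≤n with c ≤? k
  ... | yes c≤k = later c≤k k≤n
  ... | no  c≰k = <⇒≤ (earlier (≰⇒> c≰k))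

  below-new : ∀ {k} → k ≤ n → k + A (suc n) < A k + suc n
  -- Transitivity through the old minimum `c`, without subtraction: the two inequalities are added
  -- and `A c + c` is cancelled.
  below-new {k} k≤n = +-cancelʳ-< (A c + c) _ _ (begin-strict
    k + A (suc n) + (A c + c)    ≡⟨ interchange₁ k (A (suc n)) (A c) c ⟩
    (k + A c) + (A (suc n) + c)  <⟨ +-mono-≤-< (weak k≤n) (≰⇒> ≰) ⟩
    (A k + c) + (suc n + A c)    ≡⟨ interchange₂ (A k) c (suc n) (A c) ⟩
    A k + suc n + (A c + c)      ∎)
    where
    open ≤-Reasoning
    interchange₁ : ∀ a b c d → a + b + (c + d) ≡ (a + c) + (b + d)
    interchange₁ = solve-∀
    interchange₂ : ∀ a b c d → (a + b) + (c + d) ≡ a + c + (d + b)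
    interchange₂ = solve-∀

-- Counting the letters of a shifted word

module _ {N : ℕ} where

  below : List (Fin N) → ℕ → ℕ
  below xs k = length (filter (λ x → toℕ x <? k) xs)

  infixl 6 _⊕_ _⊖_

  _⊕_ _⊖_ : Fin N → Fin N → Fin N
  x ⊕ c = x ⊞ toℕ c
  x ⊖ c = x ⊞ (N ∸ toℕ c)

  ⊖-⊕ : ∀ x c → x ⊖ c ⊕ c ≡ x
  ⊖-⊕ x c = ∸-⊞ x (<⇒≤ (toℕ<n c))

  ⊕-⊖ : ∀ x c → x ⊕ c ⊖ c ≡ x
  ⊕-⊖ x c = ⊞-∸ x (<⇒≤ (toℕ<n c))

-- Subtracting `c` does not wrap around here. Having `toℕ c` on the left keeps truncated subtraction
-- out of the statement.
toℕ-⊖-≥ : ∀ {N} (x c : Fin N) → toℕ c ≤ toℕ x → toℕ c + toℕ (x ⊖ c) ≡ toℕ x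
toℕ-⊖-≥ {N@(suc _)} x c c≤x = begin
  toℕ c + toℕ (x ⊖ c)                  ≡⟨ cong (toℕ c +_) (toℕ-⊞ x (N ∸ toℕ c)) ⟩
  toℕ c + (toℕ x + (N ∸ toℕ c)) % N    ≡⟨ cong (λ y → toℕ c + y % N) wrap ⟩
  toℕ c + (toℕ x ∸ toℕ c + N) % N      ≡⟨ cong (toℕ c +_) ([m+n]%n≡m%n (toℕ x ∸ toℕ c) N) ⟩
  toℕ c + (toℕ x ∸ toℕ c) % N          ≡⟨ cong (toℕ c +_) (m<n⇒m%n≡m
    (≤-<-trans (m∸n≤m (toℕ x) (toℕ c)) (toℕ<n x))) ⟩
  toℕ c + (toℕ x ∸ toℕ c)              ≡⟨ m+[n∸m]≡n c≤x ⟩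
  toℕ x                                ∎
  where
  open ≡-Reasoning
  wrap : toℕ x + (N ∸ toℕ c) ≡ toℕ x ∸ toℕ c + N
  wrap = begin
    toℕ x + (N ∸ toℕ c)                    ≡⟨ cong (_+ (N ∸ toℕ c)) (m∸n+n≡m c≤x) ⟨
    toℕ x ∸ toℕ c + toℕ c + (N ∸ toℕ c)    ≡⟨ +-assoc (toℕ x ∸ toℕ c) (toℕ c) _ ⟩
    toℕ x ∸ toℕ c + (toℕ c + (N ∸ toℕ c))  ≡⟨ cong ((toℕ x ∸ toℕ c) +_) (m+[n∸m]≡n (<⇒≤ (toℕ<n c))) ⟩
    toℕ x ∸ toℕ c + N                      ∎

toℕ-⊖-< : ∀ {N} (x c : Fin N) → toℕ x < toℕ c → toℕ c + toℕ (x ⊖ c) ≡ toℕ x + N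
toℕ-⊖-< {N@(suc _)} x c x<c = begin
  toℕ c + toℕ (x ⊖ c)                ≡⟨ cong (toℕ c +_) (toℕ-⊞ x (N ∸ toℕ c)) ⟩
  toℕ c + (toℕ x + (N ∸ toℕ c)) % N  ≡⟨ cong (toℕ c +_) (m<n⇒m%n≡m small) ⟩
  toℕ c + (toℕ x + (N ∸ toℕ c))      ≡⟨ +-comm (toℕ c) _ ⟩
  toℕ x + (N ∸ toℕ c) + toℕ c        ≡⟨ +-assoc (toℕ x) _ _ ⟩
  toℕ x + (N ∸ toℕ c + toℕ c)        ≡⟨ cong (toℕ x +_) (m∸n+n≡m (<⇒≤ (toℕ<n c))) ⟩
  toℕ x + N                          ∎
  where
  open ≡-Reasoning
  small : toℕ x + (N ∸ toℕ c) < N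
  small = subst (toℕ x + (N ∸ toℕ c) <_) (m+[n∸m]≡n (<⇒≤ (toℕ<n c))) (+-monoˡ-< (N ∸ toℕ c) x<c)

module _ {N : ℕ} (c : Fin N) (j : ℕ) where

  private
    inWindow : ∀ x → Set
    inWindow x = toℕ (x ⊖ c) < j

  -- The letters that fall below `j` after subtracting `c` are those in the window c, ..., c + j -
  -- 1. If the window ends by `N`, it and the letters below `c` partition the letters below `c + j`.
  below-window : toℕ c + j ≤ N → ∀ xs →
    below xs (toℕ c + j) ≡ below xs (toℕ c) + below (map (_⊖ c) xs) j
  below-window c+j≤N xs = trans
    (length-filter-⊎ (λ x → toℕ x <? toℕ c) (λ x → toℕ (x ⊖ c) <? j) (λ x → toℕ x <? toℕ c + j)
      split (λ x<c → ≤-trans x<c (m≤m+n (toℕ c) j)) window⇒< disjoint xs)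
    (cong (below xs (toℕ c) +_) (sym (length-filter-map (_⊖ c) (λ x → toℕ x <? j) xs)))
    where
    split : ∀ {x} → toℕ x < toℕ c + j → toℕ x < toℕ c ⊎ inWindow x
    split {x} x<c+j with toℕ x <? toℕ c
    ... | yes x<c = inj₁ x<c
    ... | no  x≮c = inj₂ (+-cancelˡ-< (toℕ c) _ _
      (subst (_< toℕ c + j) (sym (toℕ-⊖-≥ x c (≮⇒≥ x≮c))) x<c+j))

    disjoint : ∀ {x} → toℕ x < toℕ c → ¬ inWindow x
    disjoint {x} x<c y<j = <⇒≱ (+-monoʳ-< (toℕ c) y<j)
      (≤-trans c+j≤N (subst (N ≤_) (sym (toℕ-⊖-< x c x<c)) (m≤n+m N (toℕ x))))

    window⇒< : ∀ {x} → inWindow x → toℕ x < toℕ c + j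
    window⇒< {x} y<j with toℕ x <? toℕ c
    ... | yes x<c = ≤-trans x<c (m≤m+n (toℕ c) j)
    ... | no  x≮c = subst (_< toℕ c + j) (toℕ-⊖-≥ x c (≮⇒≥ x≮c)) (+-monoʳ-< (toℕ c) y<j)

  -- Here the window passes `N` and consists of the residues from `c` upwards together with those
  -- below `k`. Adding the letters below `c` completes the first piece to the whole word.
  below-wrapped-window : ∀ k → toℕ c + j ≡ N + k → k ≤ toℕ c → ∀ xs →
    length xs + below xs k ≡ below xs (toℕ c) + below (map (_⊖ c) xs) j
  below-wrapped-window k c+j≡N+k k≤c xs = begin
    length xs + below xs k
      ≡⟨ cong (λ ys → length ys + below xs k) (filter-all (λ x → toℕ x <? N) (ListAll.universal toℕ<n xs)) ⟨
    below xs N + below xs k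
      ≡⟨ cong (_+ below xs k) (length-filter-⊎ (λ x → toℕ x <? toℕ c) (λ x → toℕ c ≤? toℕ x) (λ x → toℕ x <? N)
           (λ {x} _ → <-≤-connex (toℕ x) (toℕ c)) (λ {x} _ → toℕ<n x) (λ {x} _ → toℕ<n x) <⇒≱ xs) ⟩
    below xs (toℕ c) + #≥c + below xs k
      ≡⟨ +-assoc (below xs (toℕ c)) #≥c (below xs k) ⟩
    below xs (toℕ c) + (#≥c + below xs k)
      ≡⟨ cong (below xs (toℕ c) +_) (length-filter-⊎ (λ x → toℕ c ≤? toℕ x) (λ x → toℕ x <? k)
           (λ x → toℕ (x ⊖ c) <? j) split (λ {x} → ≥⇒window {x}) (λ {x} → <⇒window {x})
           (λ c≤x x<k → <⇒≱ x<k (≤-trans k≤c c≤x)) xs) ⟨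
    below xs (toℕ c) + length (filter (λ x → toℕ (x ⊖ c) <? j) xs)
      ≡⟨ cong (below xs (toℕ c) +_) (length-filter-map (_⊖ c) (λ x → toℕ x <? j) xs) ⟨
    below xs (toℕ c) + below (map (_⊖ c) xs) j ∎
    where
    open ≡-Reasoning
    #≥c = length (filter (λ x → toℕ c ≤? toℕ x) xs)

    split : ∀ {x} → inWindow x → toℕ c ≤ toℕ x ⊎ toℕ x < k
    split {x} y<j with toℕ x <? toℕ c
    ... | no  x≮c = inj₁ (≮⇒≥ x≮c)
    ... | yes x<c = inj₂ (+-cancelˡ-< N _ _ (subst (N + toℕ x <_) c+j≡N+k
      (subst (_< toℕ c + j) (trans (toℕ-⊖-< x c x<c) (+-comm (toℕ x) N)) (+-monoʳ-< (toℕ c) y<j))))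

    ≥⇒window : ∀ {x} → toℕ c ≤ toℕ x → inWindow x
    ≥⇒window {x} c≤x = +-cancelˡ-< (toℕ c) _ _ (subst (_< toℕ c + j) (sym (toℕ-⊖-≥ x c c≤x))
      (subst (toℕ x <_) (sym c+j≡N+k) (≤-trans (toℕ<n x) (m≤m+n N k))))

    <⇒window : ∀ {x} → toℕ x < k → inWindow x
    <⇒window {x} x<k = +-cancelˡ-< (toℕ c) _ _
      (subst (_< toℕ c + j) (sym (trans (toℕ-⊖-< x c (≤-trans x<k k≤c)) (+-comm (toℕ x) N)))
        (subst (N + toℕ x <_) (sym c+j≡N+k) (+-monoʳ-< N x<k)))

module _ {n : ℕ} (c : Fin (suc n)) (xs : List (Fin (suc n))) (∣xs∣≡n : length xs ≡ n) where

  private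
    A = below xs
    B = below (map (_⊖ c) xs)
    c≤n : toℕ c ≤ n
    c≤n = s≤s⁻¹ (toℕ<n c)

    window : ∀ j → toℕ c + j ≤ n → j ≤ B j ⇔ (toℕ c + j + A (toℕ c) ≤ A (toℕ c + j) + toℕ c)
    window j c+j≤n = mk⇔
      (λ j≤ → subst₂ _≤_ lhs rhs (+-monoʳ-≤ (toℕ c + A (toℕ c)) j≤))
      (λ le → +-cancelˡ-≤ (toℕ c + A (toℕ c)) j (B j) (subst₂ _≤_ (sym lhs) (sym rhs) le))
      where
      lhs : toℕ c + A (toℕ c) + j ≡ toℕ c + j + A (toℕ c)
      lhs = xy∙z≈xz∙y (toℕ c) (A (toℕ c)) j
      rhs : toℕ c + A (toℕ c) + B j ≡ A (toℕ c + j) + toℕ c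
      rhs = trans (+-assoc (toℕ c) _ _) (trans (+-comm (toℕ c) _)
        (cong (_+ toℕ c) (sym (below-window c j (m≤n⇒m≤1+n c+j≤n) xs))))

    -- The word has `n` letters while the circle has `suc n` residues; cancelling `n` leaves a
    -- surplus of one, which makes the inequality strict.
    wrapped : ∀ j k → toℕ c + j ≡ suc n + k → k ≤ toℕ c →
              j ≤ B j ⇔ (k + A (toℕ c) < A k + toℕ c)
    wrapped j k c+j≡N+k k≤c = mk⇔
      (λ j≤ → +-cancelˡ-≤ n _ _ (subst₂ _≤_ lhs rhs (+-monoʳ-≤ (toℕ c + A (toℕ c)) j≤)))
      (λ lt → +-cancelˡ-≤ (toℕ c + A (toℕ c)) j (B j) (subst₂ _≤_ (sym lhs) (sym rhs) (+-monoʳ-≤ n lt)))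
      where
      open ≡-Reasoning
      lhs : toℕ c + A (toℕ c) + j ≡ n + suc (k + A (toℕ c))
      lhs = begin
        toℕ c + A (toℕ c) + j    ≡⟨ xy∙z≈xz∙y (toℕ c) (A (toℕ c)) j ⟩
        toℕ c + j + A (toℕ c)    ≡⟨ cong (_+ A (toℕ c)) c+j≡N+k ⟩
        suc n + k + A (toℕ c)    ≡⟨ trans (cong suc (+-assoc n k _)) (sym (+-suc n _)) ⟩
        n + suc (k + A (toℕ c))  ∎
      rhs : toℕ c + A (toℕ c) + B j ≡ n + (A k + toℕ c)
      rhs = begin
        toℕ c + A (toℕ c) + B j    ≡⟨ +-assoc (toℕ c) _ _ ⟩
        toℕ c + (A (toℕ c) + B j)  ≡⟨ cong (toℕ c +_) (below-wrapped-window c j k c+j≡N+k k≤c xs) ⟨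
        toℕ c + (length xs + A k)  ≡⟨ cong (λ l → toℕ c + (l + A k)) ∣xs∣≡n ⟩
        toℕ c + (n + A k)          ≡⟨ trans (+-comm (toℕ c) _) (+-assoc n (A k) (toℕ c)) ⟩
        n + (A k + toℕ c)          ∎

  -- As `j` runs over 0, ..., n, the point `c + j` runs once around the circle. It meets c, ..., n
  -- before wrapping, which gives the weak inequalities, and 0, ..., c - 1 afterwards, which gives
  -- the strict ones.
  ballot⇔FirstMin : (∀ j → j ≤ n → j ≤ B j) ⇔ FirstMin A n (toℕ c)
  ballot⇔FirstMin = mk⇔ to from
    where
    to : (∀ j → j ≤ n → j ≤ B j) → FirstMin A n (toℕ c)
    to ballot = later , earlier
      where
      later : ∀ {k} → toℕ c ≤ k → k ≤ n → k + A (toℕ c) ≤ A k + toℕ c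
      later {k} c≤k k≤n = subst (λ k → k + A (toℕ c) ≤ A k + toℕ c) (m+[n∸m]≡n c≤k)
        (Equivalence.to (window (k ∸ toℕ c) (subst (_≤ n) (sym (m+[n∸m]≡n c≤k)) k≤n))
          (ballot (k ∸ toℕ c) (≤-trans (m∸n≤m k (toℕ c)) k≤n)))

      earlier : ∀ {k} → k < toℕ c → k + A (toℕ c) < A k + toℕ c
      -- The window of length `j` from `c` ends at `k` after one wrap; `k < c` ensures `j ≤ n`.
      earlier {k} k<c = Equivalence.to
        (wrapped j k (m+[n∸m]≡n (≤-trans c≤n (≤-trans (n≤1+n n) (m≤m+n (suc n) k)))) (<⇒≤ k<c))
        (ballot j (≤-trans (∸-monoʳ-≤ (suc n + k) k<c) (≤-reflexive (m+n∸n≡m n k))))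
        where j = suc n + k ∸ toℕ c

    from : FirstMin A n (toℕ c) → ∀ j → j ≤ n → j ≤ B j
    from (later , earlier) j j≤n with toℕ c + j ≤? n
    ... | yes c+j≤n = Equivalence.from (window j c+j≤n) (later (m≤m+n (toℕ c) j) c+j≤n)
    ... | no  c+j≰n = Equivalence.from (wrapped j k (sym (m+[n∸m]≡n (≰⇒> c+j≰n))) (<⇒≤ k<c)) (earlier k<c)
      where
      k = toℕ c + j ∸ suc n
      k<c : k < toℕ c
      k<c = +-cancelˡ-≤ n _ _ (subst (_≤ n + toℕ c) (sym (trans (+-suc n k) (m+[n∸m]≡n (≰⇒> c+j≰n))))
        (subst (toℕ c + j ≤_) (+-comm (toℕ c) n) (+-monoʳ-≤ (toℕ c) j≤n)))

-- Words over ℤ/(n + 1)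

Unique-map⁻ : ∀ {A B : Set} (f : A → B) {k} (v : Vec A k) → VecUnique.Unique (Vec.map f v) → VecUnique.Unique v
Unique-map⁻ f v fv! = Unique-lookup⁺ λ {i} {j} eq → Unique-lookup⁻ fv!
  (trans (Vecₚ.lookup-map i f v) (trans (cong f eq) (sym (Vecₚ.lookup-map j f v))))

module _ {n : ℕ} where

  -- Residue x stands for the value x + 1. The largest residue thus encodes n + 1, a value that no
  -- parking function takes.
  encode : Vec (Fin (suc n)) n → Vec ℕ n
  encode = Vec.map (suc ∘ toℕ)

  -- The truncation in `pred` and the reduction by `mod` only make the map total; on values in 1,
  -- ..., n it inverts the coding.
  decode : Vec ℕ n → Vec (Fin (suc n)) n
  decode = Vec.map (λ x → pred x mod suc n)

  toℕ-mod : ∀ {x} → x ≤ n → toℕ (x mod suc n) ≡ x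
  toℕ-mod {x} x≤n = trans (toℕ-fromℕ< (m%n<n x (suc n))) (m<n⇒m%n≡m (s≤s x≤n))

  decode-encode : ∀ g → decode (encode g) ≡ g
  decode-encode g = trans (sym (Vecₚ.map-∘ _ _ g)) (trans
    (Vecₚ.map-cong (λ x → toℕ-injective (toℕ-mod (s≤s⁻¹ (toℕ<n x)))) g) (Vecₚ.map-id g))

  encode-decode : ∀ {π} → IsParkingFunction π → encode (decode π) ≡ π
  encode-decode {π} pf = lookup-ext λ i → begin
    Vec.lookup (encode (decode π)) i           ≡⟨ Vecₚ.lookup-map i _ (decode π) ⟩
    suc (toℕ (Vec.lookup (decode π) i))        ≡⟨ cong (suc ∘ toℕ) (Vecₚ.lookup-map i _ π) ⟩
    suc (toℕ (pred (Vec.lookup π i) mod suc n))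
      ≡⟨ cong suc (toℕ-mod (≤-trans (pred[n]≤n {Vec.lookup π i}) (IsParkingFunction⇒≤ π pf i))) ⟩
    suc (pred (Vec.lookup π i))                ≡⟨ suc-pred (Vec.lookup π i) {{ℕ.>-nonZero (VecAllₚ.lookup⁺ (proj₁ pf) i)}} ⟩
    Vec.lookup π i                             ∎
    where open ≡-Reasoning

  IsParkingFunction⇔ballot : ∀ g → IsParkingFunction (encode g) ⇔ (∀ j → j ≤ n → j ≤ below (Vec.toList g) j)
  IsParkingFunction⇔ballot g = mk⇔
    (λ pf j j≤n → subst (j ≤_) (count j) (IsParkingFunction⇒Dominates (encode g) pf j j≤n))
    (λ ballot → Dominates⇒IsParkingFunction (encode g) (VecAllₚ.map⁺ (VecAll.universal (λ _ → s≤s z≤n) g))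
      λ j j≤n → subst (j ≤_) (sym (count j)) (ballot j j≤n))
    where
    count : ∀ j → length (filter (_≤? j) (Vec.toList (encode g))) ≡ below (Vec.toList g) j
    -- `suc (toℕ x) ≤? j` is by definition `toℕ x <? j`, so the two filters agree.
    count j = trans (cong (length ∘ filter (_≤? j)) (Vecₚ.toList-map _ g))
      (length-filter-map (suc ∘ toℕ) (_≤? j) (Vec.toList g))

  IsParkingFunction⇔FirstMin : ∀ c f → IsParkingFunction (encode (Vec.map (_⊖ c) f)) ⇔
                               FirstMin (below (Vec.toList f)) n (toℕ c)
  IsParkingFunction⇔FirstMin c f = mk⇔
    (λ pf → to (subst (λ xs → ∀ j → j ≤ n → j ≤ below xs j) eq (Equivalence.to (IsParkingFunction⇔ballot _) pf)))
    (λ min → Equivalence.from (IsParkingFunction⇔ballot _)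
      (subst (λ xs → ∀ j → j ≤ n → j ≤ below xs j) (sym eq) (from min)))
    where
    open Equivalence (ballot⇔FirstMin c (Vec.toList f) (Vecₚ.length-toList f)) using (to; from)
    eq : Vec.toList (Vec.map (_⊖ c) f) ≡ map (_⊖ c) (Vec.toList f)
    eq = Vecₚ.toList-map (_⊖ c) f

  shift unshift : Fin (suc n) → Vec (Fin (suc n)) n → Vec (Fin (suc n)) n
  shift   c = Vec.map (_⊕ c)
  unshift c = Vec.map (_⊖ c)

  shift-unshift : ∀ c f → shift c (unshift c f) ≡ f
  shift-unshift c f = trans (sym (Vecₚ.map-∘ _ _ f))
    (trans (Vecₚ.map-cong (λ x → ⊖-⊕ x c) f) (Vecₚ.map-id f))

  unshift-shift : ∀ c f → unshift c (shift c f) ≡ f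
  unshift-shift c f = trans (sym (Vecₚ.map-∘ _ _ f))
    (trans (Vecₚ.map-cong (λ x → ⊕-⊖ x c) f) (Vecₚ.map-id f))

module _ (m d : ℕ) where

  private
    n N : ℕ
    n = m + d
    N = suc n

  open DistinctPrefix m d

  distinctPrefixWords : List (Vec (Fin N) n)
  distinctPrefixWords = filter (λ f → unique? (Vec.take m f)) (vectors (allFin N) n)

  -- Pollak's circle argument: of the N cyclic shifts of a word exactly one is a parking function.
  *-distinctPrefix : N * length distinctPrefix ≡ length distinctPrefixWords
  *-distinctPrefix = begin
    N * length distinctPrefix                   ≡⟨ cong (_* length distinctPrefix) (length-allFin N) ⟨
    length (allFin N) * length distinctPrefix   ≡⟨ length-cartesianProductWith _,_ (allFin N) distinctPrefix ⟨
    length (cartesianProduct (allFin N) distinctPrefix)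
      ≡⟨ length-bijection word
           (Uniqueₚ.cartesianProduct⁺ (Uniqueₚ.allFin⁺ N) (Uniqueₚ.filter⁺ distinctPrefix? (parkingFunctions-unique n)))
           (Uniqueₚ.filter⁺ _ (vectors-unique n (Uniqueₚ.allFin⁺ N)))
           into inj surj ⟩
    length distinctPrefixWords                  ∎
    where
    open ≡-Reasoning
    word : Fin N × Vec ℕ n → Vec (Fin N) n
    word (c , π) = shift c (decode π)

    members⁻ : ∀ {c π} → (c , π) ∈ cartesianProduct (allFin N) distinctPrefix →
               IsParkingFunction π × VecUnique.Unique (Vec.take m π)
    members⁻ x∈ =
      let π∈ , π! = ∈-filter⁻ distinctPrefix? {xs = parkingFunctions n}
                      (proj₂ (∈-cartesianProduct⁻ (allFin N) distinctPrefix x∈))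
      in Equivalence.to ∈-parkingFunctions π∈ , π!

    into : ∀ {x} → x ∈ cartesianProduct (allFin N) distinctPrefix → word x ∈ distinctPrefixWords
    into {c , π} x∈ = ∈-filter⁺ _ (∈-vectors-allFin (word (c , π)))
      (subst VecUnique.Unique (sym (Vecₚ.take-map (_⊕ c) m (decode π)))
        (VecUniqueₚ.map⁺ (⊞-injectiveˡ (<⇒≤ (toℕ<n c)))
          (Unique-map⁻ (suc ∘ toℕ) (Vec.take m (decode π))
            (subst VecUnique.Unique (trans (cong (Vec.take m) (sym (encode-decode pf))) (Vecₚ.take-map _ m (decode π))) π!))))
      where
      pf = proj₁ (members⁻ x∈)
      π! = proj₂ (members⁻ x∈)

    minimal : ∀ {c π} → IsParkingFunction π → FirstMin (below (Vec.toList (word (c , π)))) n (toℕ c)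
    minimal {c} {π} pf = Equivalence.to (IsParkingFunction⇔FirstMin c (word (c , π)))
      (subst IsParkingFunction (sym (trans (cong encode (unshift-shift c (decode π))) (encode-decode pf))) pf)

    inj : ∀ {x y} → x ∈ cartesianProduct (allFin N) distinctPrefix →
          y ∈ cartesianProduct (allFin N) distinctPrefix → word x ≡ word y → x ≡ y
    -- Both shifts are the first minimum for the same word, hence equal; undoing the common shift
    -- then identifies the parking functions.
    inj {c , π} {c′ , π′} x∈ y∈ eq with toℕ-injective (FirstMin-unique (s≤s⁻¹ (toℕ<n c)) (s≤s⁻¹ (toℕ<n c′))
      (minimal {c} {π} (proj₁ (members⁻ x∈)))
      (subst (λ f → FirstMin (below (Vec.toList f)) n (toℕ c′)) (sym eq) (minimal {c′} {π′} (proj₁ (members⁻ y∈)))))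
    ... | refl = cong (c ,_) (begin
      π                                      ≡⟨ encode-decode (proj₁ (members⁻ x∈)) ⟨
      encode (decode π)                      ≡⟨ cong encode (unshift-shift c (decode π)) ⟨
      encode (unshift c (word (c , π)))      ≡⟨ cong (encode ∘ unshift c) eq ⟩
      encode (unshift c (word (c , π′)))     ≡⟨ cong encode (unshift-shift c (decode π′)) ⟩
      encode (decode π′)                     ≡⟨ encode-decode (proj₁ (members⁻ y∈)) ⟩
      π′                                     ∎)

    surj : ∀ {f} → f ∈ distinctPrefixWords →
           ∃[ x ] (x ∈ cartesianProduct (allFin N) distinctPrefix × word x ≡ f)
    surj {f} f∈ with firstMin (below (Vec.toList f)) n
    ... | c₀ , c₀≤n , min = (c , encode (unshift c f)) ,
      ∈-cartesianProduct⁺ (∈-allFin c) (∈-filter⁺ distinctPrefix? (Equivalence.from ∈-parkingFunctions pf) π!) ,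
      trans (cong (shift c) (decode-encode (unshift c f))) (shift-unshift c f)
      where
      -- The shift to undo is the first minimum `c₀`, which is at most `n` and hence a residue.
      c : Fin N
      c = fromℕ< (s≤s c₀≤n)
      pf : IsParkingFunction (encode (unshift c f))
      pf = Equivalence.from (IsParkingFunction⇔FirstMin c f)
        (subst (FirstMin (below (Vec.toList f)) n) (sym (toℕ-fromℕ< (s≤s c₀≤n))) min)
      π! : VecUnique.Unique (Vec.take m (encode (unshift c f)))
      π! = subst VecUnique.Unique (sym (trans (Vecₚ.take-map _ m (unshift c f))
             (cong (Vec.map _) (Vecₚ.take-map _ m f))))
        (VecUniqueₚ.map⁺ (toℕ-injective ∘ suc-injective)
          (VecUniqueₚ.map⁺ (⊞-injectiveˡ (m∸n≤m N (toℕ c)))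
            (proj₂ (∈-filter⁻ (λ f → unique? (Vec.take m f)) {xs = vectors (allFin N) n} f∈))))

-- Enumeration

length-vectors : ∀ {A : Set} (xs : List A) k → length (vectors xs k) ≡ length xs ^ k
length-vectors xs zero    = refl
length-vectors xs (suc k) =
  trans (length-cartesianProductWith _∷_ xs (vectors xs k)) (cong (length xs *_) (length-vectors xs k))

module _ {N : ℕ} where

  open DecMem (Fin._≟_ {N}) using (_∈?_) renaming (_∈_ to _∈ᵥ_)

  uniqueVectors : ∀ k → List (Vec (Fin N) k)
  uniqueVectors k = filter unique? (vectors (allFin N) k)

  uniqueVectors! : ∀ k → Unique (uniqueVectors k)
  uniqueVectors! k = Uniqueₚ.filter⁺ unique? (vectors-unique k (Uniqueₚ.allFin⁺ N))

  ∈-uniqueVectors⁻ : ∀ {k} {v : Vec (Fin N) k} → v ∈ uniqueVectors k → VecUnique.Unique v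
  ∈-uniqueVectors⁻ {k} = proj₂ ∘ ∈-filter⁻ unique? {xs = vectors (allFin N) k}

  ∈-uniqueVectors⁺ : ∀ {k} {v : Vec (Fin N) k} → VecUnique.Unique v → v ∈ uniqueVectors k
  ∈-uniqueVectors⁺ = ∈-filter⁺ unique? (∈-vectors-allFin _)

  length-fresh : ∀ {k} {v : Vec (Fin N) k} → VecUnique.Unique v →
                 length (filter (λ x → ¬? (x ∈? v)) (allFin N)) ≡ N ∸ k
  length-fresh {k} {v} v! = begin
    #fresh           ≡⟨ m+n∸m≡n k #fresh ⟨
    k + #fresh ∸ k   ≡⟨ cong (λ l → l + #fresh ∸ k) (trans (sym (length-allFin k)) used) ⟩
    length (filter (_∈? v) (allFin N)) + #fresh ∸ k
      ≡⟨ cong (_∸ k) (length-filter-⊎ (_∈? v) (λ x → ¬? (x ∈? v)) (λ _ → yes tt)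
           (λ {x} _ → toSum (x ∈? v)) _ _ (λ x∈ x∉ → x∉ x∈) (allFin N)) ⟨
    length (filter (λ _ → yes tt) (allFin N)) ∸ k
      ≡⟨ cong (λ xs → length xs ∸ k) (filter-all (λ _ → yes tt) (ListAll.universal _ (allFin N))) ⟩
    length (allFin N) ∸ k  ≡⟨ cong (_∸ k) (length-allFin N) ⟩
    N ∸ k            ∎
    where
    open ≡-Reasoning
    #fresh = length (filter (λ x → ¬? (x ∈? v)) (allFin N))
    used : length (allFin k) ≡ length (filter (_∈? v) (allFin N))
    used = length-bijection (Vec.lookup v) (Uniqueₚ.allFin⁺ k) (Uniqueₚ.filter⁺ (_∈? v) (Uniqueₚ.allFin⁺ N))
      (λ {i} _ → ∈-filter⁺ (_∈? v) (∈-allFin _) (VecMemₚ.∈-lookup i v))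
      (λ _ _ → Unique-lookup⁻ v!)
      (λ x∈ → let x∈v = proj₂ (∈-filter⁻ (_∈? v) {xs = allFin N} x∈)
              in VecAny.index x∈v , ∈-allFin _ , sym (VecAnyₚ.lookup-index x∈v))

  -- Each repetition-free `v` of length `k` has `N ∸ k` fresh heads, which is the recursion of
  -- `_P′_`. The pairs carry the tail first so that the product is counted tail by tail.
  length-uniqueVectors : ∀ k → length (uniqueVectors k) ≡ N P′ k
  length-uniqueVectors zero    = refl
  length-uniqueVectors (suc k) = begin
    length (uniqueVectors (suc k))  ≡⟨ length-bijection (λ (v , x) → x ∷ v)
      (Uniqueₚ.filter⁺ fresh? (Uniqueₚ.cartesianProduct⁺ (uniqueVectors! k) (Uniqueₚ.allFin⁺ N)))
      (uniqueVectors! (suc k)) into (λ { _ _ refl → refl }) surj ⟨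
    length (filter fresh? extensions)
      ≡⟨ length-filter-cartesianProduct fresh? (uniqueVectors k) (allFin N) ⟩
    sum (map (λ v → length (filter (λ x → ¬? (x ∈? v)) (allFin N))) (uniqueVectors k))
      ≡⟨ sum-map-const _ (N ∸ k) (ListAll.tabulate (length-fresh {k} ∘ ∈-uniqueVectors⁻)) ⟩
    length (uniqueVectors k) * (N ∸ k)  ≡⟨ cong (_* (N ∸ k)) (length-uniqueVectors k) ⟩
    (N P′ k) * (N ∸ k)                    ≡⟨ *-comm (N P′ k) (N ∸ k) ⟩
    N P′ suc k                          ∎
    where
    open ≡-Reasoning
    extensions = cartesianProduct (uniqueVectors k) (allFin N)

    fresh? : Decidable (λ ((v , x) : Vec (Fin N) k × Fin N) → ¬ x ∈ᵥ v)
    fresh? (v , x) = ¬? (x ∈? v)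

    into : ∀ {y} → y ∈ filter fresh? extensions → proj₂ y ∷ proj₁ y ∈ uniqueVectors (suc k)
    into {v , x} y∈ =
      let y∈′ , x∉v = ∈-filter⁻ fresh? {xs = extensions} y∈
      in ∈-uniqueVectors⁺
        (VecAllₚ.lookup⁻ (λ i eq → x∉v (subst (_∈ᵥ v) (sym eq) (VecMemₚ.∈-lookup i v)))
         ∷ ∈-uniqueVectors⁻ (proj₁ (∈-cartesianProduct⁻ (uniqueVectors k) (allFin N) y∈′)))

    surj : ∀ {w} → w ∈ uniqueVectors (suc k) → ∃[ y ] (y ∈ filter fresh? extensions × proj₂ y ∷ proj₁ y ≡ w)
    surj {x ∷ v} w∈ with ∈-uniqueVectors⁻ w∈
    ... | x∉v ∷ v! = (v , x) , ∈-filter⁺ fresh?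
      (∈-cartesianProduct⁺ (∈-uniqueVectors⁺ v!) (∈-allFin x)) (λ x∈v → VecAll.lookup x∉v x∈v refl) , refl

length-distinctPrefixWords : ∀ m d → length (distinctPrefixWords m d) ≡ (suc (m + d) P′ m) * suc (m + d) ^ d
length-distinctPrefixWords m d = begin
  length (distinctPrefixWords m d)    ≡⟨ length-bijection (uncurry Vec._++_)
    (Uniqueₚ.cartesianProduct⁺ (uniqueVectors! m) (vectors-unique d (Uniqueₚ.allFin⁺ N)))
    (Uniqueₚ.filter⁺ _ (vectors-unique (m + d) (Uniqueₚ.allFin⁺ N)))
    (λ {(u , w)} x∈ → ∈-filter⁺ _ (∈-vectors-allFin (u Vec.++ w)) (subst VecUnique.Unique (sym (take-++ u w))
      (∈-uniqueVectors⁻ (proj₁ (∈-cartesianProduct⁻ (uniqueVectors m) (vectors (allFin N) d) x∈)))))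
    (λ {(u , w)} {(u′ , w′)} _ _ eq → cong₂ _,_ (Vecₚ.++-injectiveˡ u u′ eq) (Vecₚ.++-injectiveʳ u u′ eq))
    (λ {f} f∈ → (Vec.take m f , Vec.drop m f) ,
      ∈-cartesianProduct⁺
        (∈-uniqueVectors⁺ (proj₂ (∈-filter⁻ (λ f → unique? (Vec.take m f)) {xs = vectors (allFin N) (m + d)} f∈)))
        (∈-vectors-allFin (Vec.drop m f)) ,
      Vecₚ.take++drop≡id m f) ⟨
  length (cartesianProduct (uniqueVectors m) (vectors (allFin N) d))
    ≡⟨ length-cartesianProductWith _,_ (uniqueVectors m) (vectors (allFin N) d) ⟩
  length (uniqueVectors {N} m) * length (vectors (allFin N) d)
    ≡⟨ cong₂ _*_ (length-uniqueVectors m)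
         (trans (length-vectors (allFin N) d) (cong (_^ d) (length-allFin N))) ⟩
  (N P′ m) * N ^ d                    ∎
  where
  open ≡-Reasoning
  N : ℕ
  N = suc (m + d)

  take-++ : ∀ {A : Set} (u : Vec A m) (w : Vec A d) → Vec.take m (u Vec.++ w) ≡ u
  take-++ u w = Vecₚ.++-injectiveˡ _ u (Vecₚ.take++drop≡id m (u Vec.++ w))

-- An empty prefix is vacuously distinct, so the circle argument with `m = 0` enumerates all parking
-- functions.
*-length-parkingFunctions : ∀ n → suc n * length (parkingFunctions n) ≡ suc n ^ n
*-length-parkingFunctions n = begin
  suc n * length (parkingFunctions n)
    ≡⟨ cong (λ πs → suc n * length πs) (filter-all distinctPrefix? (ListAll.universal (λ _ → []) (parkingFunctions n))) ⟨
  suc n * length distinctPrefix         ≡⟨ *-distinctPrefix 0 n ⟩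
  length (distinctPrefixWords 0 n)      ≡⟨ length-distinctPrefixWords 0 n ⟩
  1 * suc n ^ n                         ≡⟨ *-identityˡ (suc n ^ n) ⟩
  suc n ^ n                             ∎
  where
  open ≡-Reasoning
  open DistinctPrefix 0 n

-- The binomial coefficient is a quotient by `k !`, so divisibility of the falling factorial is what
-- turns it into a product. `_P_` and `_P′_` agree because both equal n! / (n - k)!.
P′≡k!*C : ∀ {n k} → k ≤ n → n P′ k ≡ k ! * (n C k)
P′≡k!*C {n} {k} k≤n = begin
  n P′ k                       ≡⟨ DivMod.m*[n/m]≡n (k!∣nP′k k≤n) ⟨
  k ! * ((n P′ k) DivMod./ k !)  ≡⟨ cong (λ p → k ! * (p DivMod./ k !))
    (trans (nPk≡n!/[n∸k]! k≤n) (sym (nP′k≡n!/[n∸k]! k≤n))) ⟨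
  k ! * ((n P k) DivMod./ k !)   ≡⟨ cong (k ! *_) (nCk≡nPk/k! k≤n) ⟨
  k ! * (n C k)                ∎
  where
  open ≡-Reasoning
  instance _ = k !≢0

-- From counts to the expectation

sum-#cycles-+ : ∀ m d .{{_ : NonZero m}} →
  sum (map (#cycles m) (parkingFunctions (m + d))) * suc (m + d) ^ m ≡
  pred m ! * (suc (m + d) C m) * length (parkingFunctions (m + d))
-- The factor `m` brings in the rotations of a cycle and `N` the shifts of a word; both counts are
-- known only after multiplication by these factors.
sum-#cycles-+ m@(suc m-1) d = *-cancelˡ-≡ _ _ (N * m) (begin
  N * m * (S * N ^ m)                 ≡⟨ shuffle₁ N m S (N ^ m) ⟩
  N * (m * S) * N ^ m                 ≡⟨ cong (λ x → N * x * N ^ m) *-sum-#cycles ⟩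
  N * length distinctPrefix * N ^ m   ≡⟨ cong (_* N ^ m) (trans (*-distinctPrefix m d) (length-distinctPrefixWords m d)) ⟩
  (N P′ m) * N ^ d * N ^ m              ≡⟨ *-assoc (N P′ m) (N ^ d) (N ^ m) ⟩
  (N P′ m) * (N ^ d * N ^ m)            ≡⟨ cong ((N P′ m) *_)
    (trans (*-comm (N ^ d) (N ^ m)) (sym (^-distribˡ-+-* N m d))) ⟩
  (N P′ m) * N ^ (m + d)
    ≡⟨ cong₂ _*_ (P′≡k!*C (≤-trans (m≤m+n m d) (n≤1+n (m + d)))) (sym (*-length-parkingFunctions (m + d))) ⟩
  m * m-1 ! * (N C m) * (N * #PF)     ≡⟨ shuffle₂ m (m-1 !) (N C m) N #PF ⟩
  N * m * (m-1 ! * (N C m) * #PF)     ∎)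
  where
  open ≡-Reasoning
  open DistinctPrefix m d
  open CyclesAsPrefixes m d
  N S #PF : ℕ
  N = suc (m + d)
  S = sum (map (#cycles m) (parkingFunctions (m + d)))
  #PF = length (parkingFunctions (m + d))

  shuffle₁ : ∀ a b c e → a * b * (c * e) ≡ a * (b * c) * e
  shuffle₁ = solve-∀

  shuffle₂ : ∀ a b c e f → a * b * c * (e * f) ≡ e * a * (b * c * f)
  shuffle₂ = solve-∀

sum-#cycles : ∀ m n .{{_ : NonZero m}} → m ≤ n →
  sum (map (#cycles m) (parkingFunctions n)) * suc n ^ m ≡
  pred m ! * (suc n C m) * length (parkingFunctions n)
sum-#cycles m n m≤n =
  subst (λ n → sum (map (#cycles m) (parkingFunctions n)) * suc n ^ m ≡
               pred m ! * (suc n C m) * length (parkingFunctions n))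
    (m+[n∸m]≡n m≤n) (sum-#cycles-+ m (n ∸ m))

open import Data.Integer using (+_)

-- `_/_` reduces to lowest terms, so the comparison is made between unnormalised fractions, where
-- equality is cross-multiplication.
/-cross : ∀ a b c d .{{_ : NonZero b}} .{{_ : NonZero d}} → a * d ≡ c * b → + a / b ≡ + c / d
/-cross a b@(suc b-1) c d@(suc d-1) eq = ℚₚ.fromℚᵘ-cong {mkℚᵘ (+ a) b-1} {mkℚᵘ (+ c) d-1} (*≡* (begin
  + a ℤ.* + d  ≡⟨ ℤₚ.pos-* a d ⟨
  + (a * d)    ≡⟨ cong +_ eq ⟩
  + (c * b)    ≡⟨ ℤₚ.pos-* c b ⟩
  + c ℤ.* + b  ∎))
  where open ≡-Reasoning

𝔼-cross : ∀ n (X : Vec ℕ n → ℕ) c d .{{_ : NonZero d}} →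
  sum (map X (parkingFunctions n)) * d ≡ c * length (parkingFunctions n) → 𝔼 n X ≡ + c / d
𝔼-cross n X c d = /-cross (sum (map X (parkingFunctions n))) (length (parkingFunctions n)) c d {{parkingFunctions-nonEmpty n}}

theorem2p4 : ∀ (m n : ℕ) .{{_ : NonZero m}} → m ≤ n →
    𝔼 n (#cycles m) ≡ _/_ (+ (pred m ! * (suc n C m))) (suc n ^ m) {{m^n≢0 (suc n) m}}
theorem2p4 m n m≤n = 𝔼-cross n (#cycles m) (pred m ! * (suc n C m)) (suc n ^ m) {{m^n≢0 (suc n) m}}
  (sum-#cycles m n m≤n)
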